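{- For every pair of integers $g\ge 3$ and $k\ge 1$, there exists a (finite) grounded square box graph with girth at least $g$ and chromatic number at least $k$.
   Context: An axis-aligned box in $\mathbb{R}^3$ is a set of the form $[a_1,b_1]\times[a_2,b_2]\times[a_3,b_3]$ with real numbers $a_i\le b_i$. It is a square box if its top and bottom faces (the faces orthogonal to the $z$-axis) are squares, i.e. $b_1-a_1=b_2-a_2$. Let $P_{x=y}=\{(x,y,z)\in\mathbb{R}^3 : x=y\}$. A square box $B\subset\mathbb{R}^3$ is grounded if $B\cap P_{x=y}\neq\emptyset$ and every point $(x,y,z)\in B$ satisfies $x\ge y$. The intersection graph of a collection of sets is the simple graph whose vertices are the sets of the collection, two distinct sets being adjacent if and only if they have non-empty intersection. A graph is a grounded square box graph if it is the intersection graph of a (finite) collection of grounded square boxes. The girth of a graph is the length of its shortest cycle ($\infty$ if the graph has no cycle). -}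

module Defs where

open import Data.Fin.Base using (Fin; zero; suc; inject₁; fromℕ)
open import Data.Fin.Patterns using (0F; 1F)
open import Data.Nat.Base as ℕ using (ℕ)
import Data.Nat.Properties as ℕ
open import Data.Product.Base using (Σ-syntax; ∃-syntax; _×_; _,_)
open import Data.Rational.Base as ℚ using (ℚ; 0ℚ; ½)
import Data.Rational.Properties as ℚ
open import Data.Rational.Solver using (module +-*-Solver)
open import Data.Vec.Functional using (Vector)
open import Function.Base using (_∘_)
open import Function.Bundles using (_↔_; _⇔_; Inverse)
open import Function.Definitions using (Injective)
open import Level using (0ℓ)
open import Relation.Binary.Construct.Add.Supremum.NonStrict ℕ._≤_ using (_≤⁺_) public
open import Relation.Binary.Core using (Rel)
open import Relation.Binary.Definitions using (Symmetric; Irreflexive)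
open import Relation.Binary.PropositionalEquality
  using (_≡_; _≢_; refl; sym; subst; cong)
open import Relation.Nullary.Construct.Add.Supremum using (_⁺; ⊤⁺; [_]) public
open import Relation.Nullary.Negation.Core using (¬_)
open import Relation.Unary using (Pred; _≐_; _∩_; Satisfiable)

-- ℝ is the setoid of Cauchy sequences of rationals, with _≃_ as its equality.

IsCauchy : (ℕ → ℚ) → Set
IsCauchy x = ∀ ε → 0ℚ ℚ.< ε →
  ∃[ N ] ∀ m n → N ℕ.≤ m → N ℕ.≤ n → ℚ.∣ x m ℚ.- x n ∣ ℚ.< ε

record ℝ : Set where
  constructor mkℝ
  field
    approx : ℕ → ℚ
    cauchy : IsCauchy approx

open ℝ public

infix 4 _≃_ _≤_ _≥_
infixl 6 _-_

_≃_ : Rel ℝ 0ℓ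
x ≃ y = ∀ ε → 0ℚ ℚ.< ε →
  ∃[ N ] ∀ n → N ℕ.≤ n → ℚ.∣ approx x n ℚ.- approx y n ∣ ℚ.< ε

_≤_ : Rel ℝ 0ℓ
x ≤ y = ∀ ε → 0ℚ ℚ.< ε →
  ∃[ N ] ∀ n → N ℕ.≤ n → approx x n ℚ.< approx y n ℚ.+ ε

_≥_ : Rel ℝ 0ℓ
x ≥ y = y ≤ x

private
  ½*-pos : ∀ {ε} → 0ℚ ℚ.< ε → 0ℚ ℚ.< ½ ℚ.* ε
  ½*-pos {ε} 0<ε = subst (ℚ._< ½ ℚ.* ε) (ℚ.*-zeroʳ ½) (ℚ.*-monoʳ-<-pos ½ 0<ε)

  ½+½ : ∀ ε → ½ ℚ.* ε ℚ.+ ½ ℚ.* ε ≡ ε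
  ½+½ = solve 1 (λ e → con ½ :* e :+ con ½ :* e := e) refl
    where open +-*-Solver

  interchange : ∀ a b c d → (a ℚ.- c) ℚ.- (b ℚ.- d) ≡ (a ℚ.- b) ℚ.- (c ℚ.- d)
  interchange = solve 4
    (λ a b c d → (a :- c) :- (b :- d) := (a :- b) :- (c :- d)) refl
    where open +-*-Solver

  -‿cauchy : ∀ {x y} → IsCauchy x → IsCauchy y → IsCauchy (λ n → x n ℚ.- y n)
  -‿cauchy {x} {y} cx cy ε 0<ε with cx (½ ℚ.* ε) (½*-pos 0<ε) | cy (½ ℚ.* ε) (½*-pos 0<ε)
  ... | N , p | M , q = N ℕ.⊔ M , λ m n N⊔M≤m N⊔M≤n → begin-strict
    ℚ.∣ (x m ℚ.- y m) ℚ.- (x n ℚ.- y n) ∣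
      ≡⟨ cong ℚ.∣_∣ (interchange (x m) (x n) (y m) (y n)) ⟩
    ℚ.∣ (x m ℚ.- x n) ℚ.- (y m ℚ.- y n) ∣
      ≤⟨ ℚ.∣p-q∣≤∣p∣+∣q∣ (x m ℚ.- x n) (y m ℚ.- y n) ⟩
    ℚ.∣ x m ℚ.- x n ∣ ℚ.+ ℚ.∣ y m ℚ.- y n ∣
      <⟨ ℚ.+-mono-< (p m n (ℕ.m⊔n≤o⇒m≤o N M N⊔M≤m) (ℕ.m⊔n≤o⇒m≤o N M N⊔M≤n))
                    (q m n (ℕ.m⊔n≤o⇒n≤o N M N⊔M≤m) (ℕ.m⊔n≤o⇒n≤o N M N⊔M≤n)) ⟩
    ½ ℚ.* ε ℚ.+ ½ ℚ.* ε
      ≡⟨ ½+½ ε ⟩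
    ε ∎
    where open ℚ.≤-Reasoning

_-_ : ℝ → ℝ → ℝ
x - y = mkℝ (λ n → approx x n ℚ.- approx y n) (-‿cauchy {approx x} {approx y} (cauchy x) (cauchy y))

-- The coordinates x, y, z are those at indices 0F, 1F, 2F.
Point : Set
Point = Vector ℝ 3

record Box : Set where
  field
    lower upper : Vector ℝ 3
    lower≤upper : ∀ i → lower i ≤ upper i

open Box public

⟦_⟧ : Box → Pred Point 0ℓ
⟦ B ⟧ p = ∀ i → lower B i ≤ p i × p i ≤ upper B i

IsSquare : Box → Set
IsSquare B = upper B 0F - lower B 0F ≃ upper B 1F - lower B 1F

P[x=y] : Pred Point 0ℓ
P[x=y] p = p 0F ≃ p 1F

IsGrounded : Box → Set
IsGrounded B = Satisfiable (⟦ B ⟧ ∩ P[x=y]) × (∀ p → ⟦ B ⟧ p → p 0F ≥ p 1F)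

record SimpleGraph : Set₁ where
  field
    Vertex : Set
    Adj    : Rel Vertex 0ℓ
    symm   : Symmetric Adj
    irrefl : Irreflexive _≡_ Adj

open SimpleGraph public

infix 4 _≅_

_≅_ : SimpleGraph → SimpleGraph → Set
G ≅ H = Σ[ f ∈ Vertex G ↔ Vertex H ]
  (∀ u v → Adj G u v ⇔ Adj H (Inverse.to f u) (Inverse.to f v))

intersectionGraph : ∀ {A : Set} {n} → (Fin n → Pred A 0ℓ) → SimpleGraph
intersectionGraph {n = n} S = record
  { Vertex = Fin n
  ; Adj    = λ i j → i ≢ j × Satisfiable (S i ∩ S j)
  ; symm   = λ (i≢j , p , p∈Si , p∈Sj) → (i≢j ∘ sym) , p , p∈Sj , p∈Si
  ; irrefl = λ i≡j (i≢j , _) → i≢j i≡j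
  }

-- Injectivity makes the family a collection of sets: distinct indices name
-- distinct sets.
IsGroundedSquareBoxGraph : SimpleGraph → Set
IsGroundedSquareBoxGraph G = ∃[ n ] Σ[ B ∈ (Fin n → Box) ]
    (∀ i → IsSquare (B i) × IsGrounded (B i))
  × Injective _≡_ _≐_ (⟦_⟧ ∘ B)
  × G ≅ intersectionGraph (⟦_⟧ ∘ B)

record Cycle (G : SimpleGraph) : Set where
  field
    last      : ℕ
    3≤length  : 3 ℕ.≤ ℕ.suc last
    vertex    : Fin (ℕ.suc last) → Vertex G
    injective : Injective _≡_ _≡_ vertex
    step      : ∀ (i : Fin last) → Adj G (vertex (inject₁ i)) (vertex (suc i))
    close     : Adj G (vertex (fromℕ last)) (vertex zero)

  length : ℕ
  length = ℕ.suc last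

-- ⊤⁺ plays the role of ∞.
IsGirth : SimpleGraph → ℕ ⁺ → Set
IsGirth G ⊤⁺    = ¬ Cycle G
IsGirth G [ n ] = (Σ[ C ∈ Cycle G ] Cycle.length C ≡ n)
                × (∀ (C : Cycle G) → n ℕ.≤ Cycle.length C)

Colorable : SimpleGraph → ℕ → Set
Colorable G m = Σ[ c ∈ (Vertex G → Fin m) ] (∀ u v → Adj G u v → c u ≢ c v)

IsChromaticNumber : SimpleGraph → ℕ → Set
IsChromaticNumber G n = Colorable G n × (∀ m → Colorable G m → n ℕ.≤ m)

{-# OPTIONS --safe #-}

-- A grounded square box has the form [t, t+s] × [t−s, t] × [c, d], and two of them
-- meet iff |t − t′| ≤ min(s, s′) and their z-intervals meet. Positions t are taken to
-- be words, read in mixed radix, with the sizes s chosen so that the first condition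
-- says that the two words agree up to a number of least significant digits. By
-- pigeonhole, every colouring of the leaves of a large tree is constant on the leaves
-- of a level-preserving copy of a given tree; since only the tree structure of the
-- positions matters for adjacency, this replaces van der Waerden's theorem.
--
-- The hypergraph of these copies is unravelled, by Nešetřil–Rödl amalgamation, into a
-- hypergraph P of large girth that still has a monochromatic edge in every colouring.
-- Tutte's construction then raises the chromatic number: over each edge of P, at a
-- height of its own, stands a copy of the previous box graph, each vertex of which is
-- joined to the corresponding node of the edge, a tall and thin box. Amalgamation and
-- Tutte's construction both glue copies of a graph along the edges of a hypergraph of
-- large girth, so one lemma bounds the girth in both.

module Submission where

open import Defs
open import Data.Empty using (⊥)
open import Data.Fin.Base as Fin
  using (Fin; zero; suc; toℕ; fromℕ; fromℕ<; inject₁; inject≤; punchOut; funToFin; finToFun)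
open import Data.Fin.Patterns using (0F; 1F; 2F)
import Data.Fin.Properties as Fin
open import Data.List.Base using (List; []; _∷_; map)
open import Data.Nat.Base as ℕ using (ℕ; zero; suc; _+_; _*_; _^_; z≤n; s≤s)
import Data.Nat.Properties as ℕ
open import Data.Nat.Tactic.RingSolver using (solve)
open import Data.Product.Base using (Σ; Σ-syntax; ∃; ∃-syntax; _×_; _,_; proj₁; proj₂; map₂)
open import Data.Product.Function.NonDependent.Propositional using (_×-↔_)
open import Data.Rational.Base as ℚ using (ℚ; 0ℚ; 1ℚ; ½)
import Data.Rational.Properties as ℚ
open import Data.Rational.Solver using (module +-*-Solver)
open import Data.Sum.Base as Sum using (_⊎_; inj₁; inj₂)
open import Data.Sum.Function.Propositional using (_⊎-↔_)
open import Data.Sum.Properties using (inj₁-injective; inj₂-injective)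
open import Data.Unit.Base using (⊤; tt)
open import Function.Base using (_∘_; id)
open import Function.Bundles using (_↔_; _⇔_; Inverse; Equivalence; mk⇔)
open import Function.Definitions using (Injective)
open import Function.Properties.Inverse using (↔-refl; ↔-sym; ↔-trans; ↔⇒↣)
open import Level using (0ℓ)
open import Relation.Binary.Construct.Add.Supremum.NonStrict ℕ._≤_ using ([_]; _≤⊤⁺)
open import Relation.Binary.Core using (Rel)
import Relation.Binary.Definitions as Binary
open import Relation.Binary.PropositionalEquality
  using (_≡_; _≢_; _≗_; refl; sym; trans; cong; cong₂; subst; subst₂)
open import Relation.Nullary.Decidable as Dec using (Dec; yes; no; _×-dec_; _→-dec_; ¬?)
open import Relation.Nullary.Negation.Core using (¬_; contradiction)
open import Relation.Unary using (Decidable; _≐_; _∩_; Satisfiable)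

-- Finite types

Finite : Set → Set
Finite A = Σ[ n ∈ ℕ ] A ↔ Fin n

_⊎-finite_ : ∀ {A B} → Finite A → Finite B → Finite (A ⊎ B)
(m , f) ⊎-finite (n , g) = m + n , ↔-trans (f ⊎-↔ g) (↔-sym Fin.+↔⊎)

_×-finite_ : ∀ {A B} → Finite A → Finite B → Finite (A × B)
(m , f) ×-finite (n , g) = m * n , ↔-trans (f ×-↔ g) (↔-sym Fin.*↔×)

module _ {A : Set} (F : Finite A) where

  size : ℕ
  size = proj₁ F

  index : A → Fin size
  index = Inverse.to (proj₂ F)

  element : Fin size → A
  element = Inverse.from (proj₂ F)

  element-index : ∀ a → element (index a) ≡ a
  element-index = Inverse.strictlyInverseʳ (proj₂ F)

  index-element : ∀ i → index (element i) ≡ i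
  index-element = Inverse.strictlyInverseˡ (proj₂ F)

  index-injective : ∀ {a b} → index a ≡ index b → a ≡ b
  index-injective {a} {b} eq =
    trans (sym (element-index a)) (trans (cong element eq) (element-index b))

  finite⇒≟ : Binary.DecidableEquality A
  finite⇒≟ = Fin.inj⇒≟ (↔⇒↣ (proj₂ F))

module _ {A B : Set} (FA : Finite A) (FB : Finite B) where

  decode : Fin (size FB ^ size FA) → A → B
  decode i = element FB ∘ finToFun i ∘ index FA

  encode : (A → B) → Fin (size FB ^ size FA)
  encode f = funToFin (index FB ∘ f ∘ element FA)

  decode-encode : ∀ f → decode (encode f) ≗ f
  decode-encode f a = trans (cong (element FB) (Fin.finToFun-funToFin _ (index FA a)))
    (trans (element-index FB _) (cong f (element-index FA a)))

-- Pigeonhole and monochromatic subtrees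

splitColour : ∀ k N (χ : Fin N → Fin (suc k)) →
  Σ[ m ∈ ℕ ] Σ[ n ∈ ℕ ] N ≡ m + n
  × (Σ[ α ∈ (Fin m → Fin N) ] Injective _≡_ _≡_ α × (∀ i → χ (α i) ≡ zero))
  × (Σ[ β ∈ (Fin n → Fin N) ] Injective _≡_ _≡_ β
      × (Σ[ χ′ ∈ (Fin n → Fin k) ] (∀ i → χ (β i) ≡ suc (χ′ i))))
splitColour k zero χ =
  0 , 0 , refl , (id , id , λ ()) , (id , id , (λ ()) , λ ())
splitColour k (suc N) χ with χ zero in eq | splitColour k N (χ ∘ suc)
... | zero | m , n , N≡ , (α , α-inj , α-col) , (β , β-inj , χ′ , β-col) =
  suc m , n , cong suc N≡
  , (Fin.lift 1 α , Fin.lift-injective α α-inj 1 , λ { zero → eq ; (suc i) → α-col i })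
  , (suc ∘ β , β-inj ∘ Fin.suc-injective , χ′ , β-col)
... | suc c | m , n , N≡ , (α , α-inj , α-col) , (β , β-inj , χ′ , β-col) =
  m , suc n , trans (cong suc N≡) (sym (ℕ.+-suc m n))
  , (suc ∘ α , α-inj ∘ Fin.suc-injective , α-col)
  , (Fin.lift 1 β , Fin.lift-injective β β-inj 1
    , (λ { zero → c ; (suc i) → χ′ i }) , λ { zero → eq ; (suc i) → β-col i })

-- Induction on the number of colours: either class `zero` has `n` elements, or removing it costs
-- fewer than `n` and leaves enough for the remaining colours.
pigeonhole : ∀ k n N → suc k * n ℕ.≤ N → (χ : Fin N → Fin (suc k)) →
  Σ[ c ∈ Fin (suc k) ] Σ[ α ∈ (Fin n → Fin N) ]
    Injective _≡_ _≡_ α × (∀ i → χ (α i) ≡ c)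
pigeonhole zero n N n≤N χ =
  zero , (λ i → inject≤ i n≤N′) , Fin.inject≤-injective _ _ _ _ , λ i → unique (χ _)
  where
  n≤N′ = ℕ.≤-trans (ℕ.m≤m+n n _) n≤N
  unique : (c : Fin 1) → c ≡ zero
  unique zero = refl
pigeonhole (suc k) n N le χ with splitColour (suc k) N χ
... | m , m′ , N≡ , (α , α-inj , α-col) , (β , β-inj , χ′ , β-col) with ℕ.≤-<-connex n m
... | inj₁ n≤m = zero , (λ i → α (inject≤ i n≤m))
               , Fin.inject≤-injective _ _ _ _ ∘ α-inj , λ i → α-col _
... | inj₂ m<n =
  let c , γ , γ-inj , γ-col = pigeonhole k n m′ le′ χ′
  in suc c , β ∘ γ , γ-inj ∘ β-inj , λ i → trans (β-col (γ i)) (cong suc (γ-col i))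
  where
  le′ : suc k * n ℕ.≤ m′
  le′ = ℕ.+-cancelˡ-≤ n _ _ (ℕ.≤-trans (subst (n + suc k * n ℕ.≤_) N≡ le)
                                       (ℕ.+-monoˡ-≤ m′ (ℕ.<⇒≤ m<n)))

-- The least significant digit comes first.
Word : List ℕ → Set
Word []       = ⊤
Word (n ∷ ns) = Fin n × Word ns

Word-finite : ∀ ns → Finite (Word ns)
Word-finite []       = 1 , ↔-sym Fin.1↔⊤
Word-finite (n ∷ ns) = (n , ↔-refl) ×-finite Word-finite ns

-- u and w coincide after deletion of their j least significant digits.
Agree : ∀ ns → ℕ → Word ns → Word ns → Set
Agree []       j       u       w       = ⊤
Agree (n ∷ ns) zero    (a , u) (b , w) = a ≡ b × Agree ns zero u w
Agree (n ∷ ns) (suc j) (a , u) (b , w) = Agree ns j u w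

Agree-refl : ∀ ns j w → Agree ns j w w
Agree-refl []       j       w       = tt
Agree-refl (n ∷ ns) zero    (a , w) = refl , Agree-refl ns zero w
Agree-refl (n ∷ ns) (suc j) (a , w) = Agree-refl ns j w

Agree-sym : ∀ ns j {u w} → Agree ns j u w → Agree ns j w u
Agree-sym []       j       p       = tt
Agree-sym (n ∷ ns) zero    (p , q) = sym p , Agree-sym ns zero q
Agree-sym (n ∷ ns) (suc j) p       = Agree-sym ns j p

Agree-zero⇒≡ : ∀ ns {u w} → Agree ns 0 u w → u ≡ w
Agree-zero⇒≡ []       p       = refl
Agree-zero⇒≡ (n ∷ ns) (p , q) = cong₂ _,_ p (Agree-zero⇒≡ ns q)

Agree? : ∀ ns j u w → Dec (Agree ns j u w)
Agree? []       j       u       w       = yes tt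
Agree? (n ∷ ns) zero    (a , u) (b , w) = a Fin.≟ b ×-dec Agree? ns zero u w
Agree? (n ∷ ns) (suc j) (a , u) (b , w) = Agree? ns j u w

-- By pigeonhole every tail `u` has a colour shared by `n` of its extensions by a least digit; with
-- the tails coloured so, the recursion selects tails of one colour. Each digit is chosen
-- injectively and depends only on the more significant ones, which preserves agreement both ways.
monochromaticSubtree : ∀ k ns (χ : Word (map (suc k *_) ns) → Fin (suc k)) →
  Σ[ c ∈ Fin (suc k) ] Σ[ f ∈ (Word ns → Word (map (suc k *_) ns)) ]
    (∀ u → χ (f u) ≡ c) × (∀ j u w → Agree _ j u w ⇔ Agree _ j (f u) (f w))
monochromaticSubtree k [] χ = χ tt , id , (λ _ → refl) , λ _ _ _ → mk⇔ id id
monochromaticSubtree k (n ∷ ns) χ =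
  let c , f , f-col , f-agree = monochromaticSubtree k ns (proj₁ ∘ digit)
      α = λ u → proj₁ (proj₂ (digit u))
      α-inj : ∀ u → Injective _≡_ _≡_ (α u)
      α-inj = λ u → proj₁ (proj₂ (proj₂ (digit u)))
      α-col = λ u → proj₂ (proj₂ (proj₂ (digit u)))
  in c
   , (λ (a , u) → α (f u) a , f u)
   , (λ (a , u) → trans (α-col (f u) a) (f-col u))
   , λ { zero (a , u) (b , w) → mk⇔
           -- The digit map `α` depends on the tail, so the tails are identified before the digits
           -- are compared.
           (λ (a≡b , p) → cong₂ (λ v → α (f v)) (Agree-zero⇒≡ ns p) a≡b
                        , Equivalence.to (f-agree zero u w) p)
           (λ (p , q) → let r = Equivalence.from (f-agree zero u w) q in
              α-inj (f u) (trans p (cong (λ v → α (f v) b) (sym (Agree-zero⇒≡ ns r)))) , r)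
       ; (suc j) (a , u) (b , w) → f-agree j u w }
  where
  digit = λ u → pigeonhole k n (suc k * n) ℕ.≤-refl (λ a → χ (a , u))

-- Walks, girth and gluing

-- Walk _~_ x y z n: a walk of length n from x to z whose first step goes to y
-- and which never turns back along the edge it has just used.
data Walk {A : Set} (_~_ : Rel A 0ℓ) : A → A → A → ℕ → Set where
  step : ∀ {x y} → x ~ y → Walk _~_ x y y 1
  _,⟨_⟩_ : ∀ {x y y′ z n} → x ~ y → x ≢ y′ → Walk _~_ y y′ z n → Walk _~_ x y z (suc n)

infixr 5 _,⟨_⟩_

-- A graph contains a cycle of length at most n as soon as it contains a closed
-- walk without turning back of length n > 0, so this bounds the girth.
Girth≥ : ∀ {A : Set} → Rel A 0ℓ → ℕ → Set
Girth≥ _~_ g = ∀ {x y n} → Walk _~_ x y x n → g ℕ.≤ n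

Walk-positive : ∀ {A : Set} {_~_ : Rel A 0ℓ} {x y z n} → Walk _~_ x y z n → 1 ℕ.≤ n
Walk-positive (step _)       = s≤s z≤n
Walk-positive (_ ,⟨ _ ⟩ _) = s≤s z≤n

record Hypergraph (R : Set) : Set₁ where
  field
    Node Edge   : Set
    node-finite : Finite Node
    edge-finite : Finite Edge
    slot        : Edge → R → Node

open Hypergraph

Incident : ∀ {R} (H : Hypergraph R) → Rel (Node H ⊎ Edge H) 0ℓ
Incident H (inj₁ v) (inj₂ e) = ∃[ s ] slot H e s ≡ v
Incident H (inj₂ e) (inj₁ v) = ∃[ s ] slot H e s ≡ v
Incident H _        _        = ⊥

InjectiveSlots : ∀ {R} → Hypergraph R → Set
InjectiveSlots H = ∀ e → Injective _≡_ _≡_ (slot H e)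

private
  -- Crossing a copy from hub to hub takes at least three steps of the walk and contributes two in
  -- the incidence graph: lengths shrink by a factor 2/3, up to the constant `c`.
  hop-bound : ∀ m n l c → 3 ℕ.≤ m → 3 * l ℕ.≤ 2 * n + c → 3 * (2 + l) ℕ.≤ 2 * (m + n) + c
  hop-bound m n l c 3≤m le = begin
    3 * (2 + l)           ≡⟨ solve (l ∷ []) ⟩
    2 * 3 + 3 * l         ≤⟨ ℕ.+-mono-≤ (ℕ.*-monoʳ-≤ 2 3≤m) le ⟩
    2 * m + (2 * n + c)   ≡⟨ solve (m ∷ n ∷ c ∷ []) ⟩
    2 * (m + n) + c       ∎
    where open ℕ.≤-Reasoning

  closing-bound : ∀ g m n l → 3 ℕ.≤ g → g ℕ.≤ l → 3 * l ℕ.≤ 2 * (m + n) + 2 → g ℕ.< m + n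
  closing-bound g m n l 3≤g g≤l le = ℕ.≰⇒> λ m+n≤g →
    ℕ.<⇒≱ 3≤g (ℕ.+-cancelˡ-≤ (2 * g) g 2 (begin
      2 * g + g         ≡⟨ solve (g ∷ []) ⟩
      3 * g             ≤⟨ ℕ.*-monoʳ-≤ 3 g≤l ⟩
      3 * l             ≤⟨ le ⟩
      2 * (m + n) + 2   ≤⟨ ℕ.+-monoˡ-≤ 2 (ℕ.*-monoʳ-≤ 2 m+n≤g) ⟩
      2 * g + 2         ∎))
    where open ℕ.≤-Reasoning

-- A graph on B that is a union of copies of a graph on A, one for every edge of
-- H; different copies share only hubs, and the hubs of a copy are the nodes of
-- its edge, with Hub a s saying that a is the hub in slot s.
record Gluing {R A B : Set} (_~_ : Rel A 0ℓ) (_≈_ : Rel B 0ℓ) (H : Hypergraph R) : Set₁ where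
  field
    copy           : Edge H → A → B
    copy-injective : ∀ e → Injective _≡_ _≡_ (copy e)
    cover          : ∀ {x y} → x ≈ y →
      Σ[ e ∈ Edge H ] Σ[ a ∈ A ] Σ[ b ∈ A ] (a ~ b) × (copy e a ≡ x) × (copy e b ≡ y)
    Hub            : A → R → Set
    Hub-injective  : ∀ {a b s} → Hub a s → Hub b s → a ≡ b
    shared         : ∀ {e e′ a b} → e ≢ e′ → copy e a ≡ copy e′ b →
      Σ[ s ∈ R ] Σ[ t ∈ R ] Hub a s × Hub b t × slot H e s ≡ slot H e′ t
    Hub-distant    : ∀ {a b c s t n} → Hub a s → Hub c t → Walk _~_ a b c n → 3 ℕ.≤ n
    slot-injective : InjectiveSlots H

module _ {R A B : Set} {_~_ : Rel A 0ℓ} {_≈_ : Rel B 0ℓ} {H : Hypergraph R}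
         (G : Gluing _~_ _≈_ H) where
  open Gluing G

  -- The part of a walk after it left the copy e through the hub in slot s.
  data Excursion (e : Edge H) (s : R) (z : B) : ℕ → Set where
    final : ∀ {e′ t a b c n} → e ≢ e′ → slot H e s ≡ slot H e′ t → Hub a t →
            Walk _~_ a b c n → copy e′ c ≡ z → Excursion e s z n
    transit : ∀ {e′ t a b c s′ m n} → e ≢ e′ → slot H e s ≡ slot H e′ t → Hub a t →
              Walk _~_ a b c m → Hub c s′ → Excursion e′ s′ z n → Excursion e s z (m + n)

  data Decomposition (x y z : B) : ℕ → Set where
    within : ∀ {e a b c n} → copy e a ≡ x → copy e b ≡ y → copy e c ≡ z →
             Walk _~_ a b c n → Decomposition x y z n
    across : ∀ {e a b c s m n} → copy e a ≡ x → copy e b ≡ y →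
             Walk _~_ a b c m → Hub c s → Excursion e s z n → Decomposition x y z (m + n)

  -- Built from the end of the walk: a step joins the piece after it if both lie in the same copy;
  -- otherwise it starts a new piece, and `shared` makes the common point a hub of both copies.
  decompose : ∀ {x y z n} → Walk _≈_ x y z n → Decomposition x y z n
  decompose (step x≈y) with cover x≈y
  ... | e , a , b , a~b , refl , refl = within refl refl refl (step a~b)
  decompose (x≈y ,⟨ x≢y′ ⟩ w) with cover x≈y | decompose w
  ... | e , a , b , a~b , refl , refl | within {e′} p q r w′
    with finite⇒≟ (edge-finite H) e e′
  ... | yes refl with refl ← copy-injective e p =
        within refl refl r (a~b ,⟨ (λ { refl → x≢y′ q }) ⟩ w′)
  ... | no e≢e′ with shared e≢e′ (sym p)
  ...   | s , t , hub-b , hub-a , eq =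
        across refl refl (step a~b) hub-b (final e≢e′ eq hub-a w′ r)
  decompose (x≈y ,⟨ x≢y′ ⟩ w) | e , a , b , a~b , refl , refl | across {e′} p q w′ hub ex
    with finite⇒≟ (edge-finite H) e e′
  ... | yes refl with refl ← copy-injective e p =
        across refl refl (a~b ,⟨ (λ { refl → x≢y′ q }) ⟩ w′) hub ex
  ... | no e≢e′ with shared e≢e′ (sym p)
  ...   | s , t , hub-b , hub-a , eq =
        across refl refl (step a~b) hub-b (transit e≢e′ eq hub-a w′ hub ex)

  module _ {g : ℕ} (3≤g : 3 ℕ.≤ g) (girth-H : Girth≥ (Incident H) g)
           (girth-A : Girth≥ _~_ (suc g)) where

    -- Otherwise both ends would be the same hub, and the walk would be closed and too short for the
    -- girth of a copy.
    slots-differ : ∀ {e a b c s t n} → Walk _~_ a b c n → n ℕ.≤ g →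
                   Hub a s → Hub c t → slot H e s ≢ slot H e t
    slots-differ {e} w n≤g hub-a hub-c eq with slot-injective e eq
    ... | refl with Hub-injective hub-a hub-c
    ... | refl = ℕ.<⇒≱ (girth-A w) n≤g

    land : ∀ {e e′ s t} → e ≢ e′ → slot H e s ≡ slot H e′ t →
           Walk (Incident H) (inj₂ e) (inj₁ (slot H e s)) (inj₂ e′) 2
    land {e} {e′} {s} {t} e≢e′ eq =
      _,⟨_⟩_ {x = inj₂ e} {inj₁ (slot H e s)} (s , refl) (e≢e′ ∘ inj₂-injective)
        (step (t , sym eq))

    hop : ∀ {e e′ s t y z n} → e ≢ e′ → slot H e s ≡ slot H e′ t → slot H e′ t ≢ y →
          Walk (Incident H) (inj₂ e′) (inj₁ y) z n →
          Walk (Incident H) (inj₂ e) (inj₁ (slot H e s)) z (2 + n)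
    hop {e} {e′} {s} {t} e≢e′ eq ≢y w =
      _,⟨_⟩_ {x = inj₂ e} {inj₁ (slot H e s)} {inj₂ e′} (s , refl) (e≢e′ ∘ inj₂-injective)
        ((t , sym eq) ,⟨ (λ p → ≢y (trans (sym eq) (inj₁-injective p))) ⟩ w)

    -- The second alternative arises when the last copy visited is not e₀: then a₀ is a
    -- hub of both.
    trace : ∀ {e₀ a₀ e s n} → Excursion e s (copy e₀ a₀) n → n ℕ.≤ g →
      (Σ[ m ∈ ℕ ] Walk (Incident H) (inj₂ e) (inj₁ (slot H e s)) (inj₂ e₀) m
        × 3 * m ℕ.≤ 2 * n + 4)
      ⊎ (Σ[ m ∈ ℕ ] Σ[ t ∈ R ] Hub a₀ t
        × Walk (Incident H) (inj₂ e) (inj₁ (slot H e s)) (inj₁ (slot H e₀ t)) m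
        × 3 * m ℕ.≤ 2 * n + 3)
    trace {e₀} (final {e′} e≢e′ eq hub w end) n≤g with finite⇒≟ (edge-finite H) e′ e₀
    -- The last piece may end anywhere in its copy, so only its positive length is available:
    -- `3 * 2 = 2 * 1 + 4`.
    ... | yes refl = inj₁ (2 , land e≢e′ eq , ℕ.+-monoˡ-≤ 4 (ℕ.*-monoʳ-≤ 2 (Walk-positive w)))
    ... | no e′≢e₀ with shared e′≢e₀ end
    -- Here the last piece runs between two hubs, hence has length at least 3: `3 * 3 = 2 * 3 + 3`.
    ...   | t′ , s₀ , hub′ , hub₀ , eq′ = inj₂
            (3 , s₀ , hub₀
            , hop e≢e′ eq
                (λ p → slots-differ w n≤g hub hub′ (trans p (sym eq′)))
                (step (t′ , eq′))
            , ℕ.+-monoˡ-≤ 3 (ℕ.*-monoʳ-≤ 2 (Hub-distant hub hub′ w)))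
    trace (transit {m = m} {n = n} e≢e′ eq hub w hub′ ex) n≤g
      with trace ex (ℕ.m+n≤o⇒n≤o m n≤g)
         | slots-differ w (ℕ.m+n≤o⇒m≤o m n≤g) hub hub′
    ... | inj₁ (l , v , le) | s≢s′ =
      inj₁ (2 + l , hop e≢e′ eq s≢s′ v , hop-bound m n l 4 (Hub-distant hub hub′ w) le)
    ... | inj₂ (l , s₀ , hub₀ , v , le) | s≢s′ =
      inj₂ (2 + l , s₀ , hub₀ , hop e≢e′ eq s≢s′ v , hop-bound m n l 3 (Hub-distant hub hub′ w) le)

    -- A walk inside one copy is bounded by the girth of the copies. Any other traces a closed walk
    -- in the incidence graph of `H`, of length at least `g` but only about two thirds of the
    -- original, which is therefore longer than `g`.
    gluing-girth : Girth≥ _≈_ (suc g)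
    gluing-girth w with decompose w
    ... | within {e} refl refl r w′ with refl ← copy-injective e r = girth-A w′
    ... | across {m = m} {n = n} p q w′ hub ex with ℕ.≤-<-connex (m + n) g
    ...   | inj₂ g<m+n = g<m+n
    ...   | inj₁ m+n≤g with refl ← p | trace ex (ℕ.m+n≤o⇒n≤o m m+n≤g)
    ...     | inj₁ (l , v , le) = contradiction m+n≤g (ℕ.<⇒≱ (closing-bound g m n l 3≤g (girth-H v)
              (begin
                3 * l               ≤⟨ le ⟩
                2 * n + 4           ≡⟨ solve (n ∷ []) ⟩
                2 * (1 + n) + 2     ≤⟨ ℕ.+-monoˡ-≤ 2 (ℕ.*-monoʳ-≤ 2 (ℕ.+-monoˡ-≤ n (Walk-positive w′))) ⟩
                2 * (m + n) + 2     ∎)))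
      where open ℕ.≤-Reasoning
    -- The base point is itself a hub, so the incidence walk is closed up at its node and the first
    -- piece has length at least 3.
    ...     | inj₂ (l , s₀ , hub₀ , v , le) = contradiction m+n≤g (ℕ.<⇒≱ (closing-bound g m n (suc l) 3≤g
              (girth-H ((s₀ , refl) ,⟨ slots-differ w′ (ℕ.m+n≤o⇒m≤o m m+n≤g) hub₀ hub ∘ inj₁-injective ⟩ v))
              (begin
                3 * suc l           ≡⟨ solve (l ∷ []) ⟩
                3 * l + 3           ≤⟨ ℕ.+-monoˡ-≤ 3 le ⟩
                2 * n + 3 + 3       ≡⟨ solve (n ∷ []) ⟩
                2 * (3 + n)         ≤⟨ ℕ.*-monoʳ-≤ 2 (ℕ.+-monoˡ-≤ n (Hub-distant hub₀ hub w′)) ⟩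
                2 * (m + n)         ≤⟨ ℕ.m≤m+n _ 2 ⟩
                2 * (m + n) + 2     ∎)))
      where open ℕ.≤-Reasoning

-- Sparse hypergraphs

Monochromatic : ∀ {R k} (H : Hypergraph R) → (Node H → Fin k) → Set
Monochromatic {k = k} H χ = Σ[ e ∈ Edge H ] Σ[ c ∈ Fin k ] (∀ s → χ (slot H e s) ≡ c)

Ramsey : ∀ {R} → ℕ → Hypergraph R → Set
Ramsey k H = (χ : Node H → Fin k) → Monochromatic H χ

-- Indexing the edges by the colourings, each by an edge that is monochromatic for it,
-- spares the enumeration of all the maps R → N.
module _ {R N : Set} (N-finite : Finite N) (k : ℕ)
         (mono : (χ : N → Fin k) → Σ[ c ∈ Fin k ] Σ[ f ∈ (R → N) ] (∀ s → χ (f s) ≡ c)) where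

  private
    colour : Fin (k ^ size N-finite) → N → Fin k
    colour = decode N-finite (k , ↔-refl)

  colouringHypergraph : Hypergraph R
  colouringHypergraph = record
    { Node        = N
    ; Edge        = Fin (k ^ size N-finite)
    ; node-finite = N-finite
    ; edge-finite = _ , ↔-refl
    ; slot        = λ e → proj₁ (proj₂ (mono (colour e)))
    }

  colouringHypergraph-Ramsey : Ramsey k colouringHypergraph
  colouringHypergraph-Ramsey χ = e , proj₁ (mono (colour e)) , λ s →
    trans (sym (decode-encode N-finite (k , ↔-refl) χ _)) (proj₂ (proj₂ (mono (colour e))) s)
    where e = encode N-finite (k , ↔-refl) χ

module _ {R : Set} (R-finite : Finite R) (k : ℕ) where

  private
    mono : (χ : Fin (suc k * size R-finite) → Fin (suc k)) →
      Σ[ c ∈ Fin (suc k) ] Σ[ f ∈ (R → Fin (suc k * size R-finite)) ] (∀ s → χ (f s) ≡ c)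
    mono χ =
      let c , α , _ , col = pigeonhole k (size R-finite) _ ℕ.≤-refl χ
      in c , α ∘ index R-finite , col ∘ index R-finite

  -- With `R` the node set of a partite system, its sparse lift is what copies of that system are
  -- amalgamated along.
  pigeonholeHypergraph : Hypergraph R
  pigeonholeHypergraph = colouringHypergraph (_ , ↔-refl) (suc k) mono

  pigeonholeHypergraph-Ramsey : Ramsey (suc k) pigeonholeHypergraph
  pigeonholeHypergraph-Ramsey = colouringHypergraph-Ramsey (_ , ↔-refl) (suc k) mono

  pigeonholeHypergraph-injective : InjectiveSlots pigeonholeHypergraph
  pigeonholeHypergraph-injective e =
    index-injective R-finite ∘ proj₁ (proj₂ (proj₂ (pigeonhole k (size R-finite) _ ℕ.≤-refl _)))

-- A partite system over `F`: the parts are the fibres of `π`, and every edge follows an edge of `F`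
-- slot by slot.
record Lift {R : Set} (P F : Hypergraph R) : Set where
  field
    π         : Node P → Node F
    φ         : Edge P → Edge F
    slot-lift : ∀ e s → π (slot P e s) ≡ slot F (φ e) s

  lift-injective : InjectiveSlots F → InjectiveSlots P
  lift-injective inj e {s} {t} eq = inj (φ e)
    (trans (sym (slot-lift e s)) (trans (cong π eq) (slot-lift e t)))

  part-edge : InjectiveSlots F → ∀ e {u v i} → ∃[ s ] slot P e s ≡ u → ∃[ s ] slot P e s ≡ v →
              π u ≡ i → π v ≡ i → u ≡ v
  part-edge inj e (s , refl) (t , refl) p q = cong (slot P e) (inj (φ e)
    (trans (sym (slot-lift e s)) (trans p (trans (sym q) (slot-lift e t)))))

open Lift

-- The partite system that the amalgamation starts from.
module _ {R : Set} (R-finite : Finite R) (F : Hypergraph R) where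

  disjointEdges : Hypergraph R
  disjointEdges = record
    { Node        = Edge F × R
    ; Edge        = Edge F
    ; node-finite = edge-finite F ×-finite R-finite
    ; edge-finite = edge-finite F
    ; slot        = _,_
    }

  disjointEdges-lift : Lift disjointEdges F
  disjointEdges-lift = record { π = λ (e , s) → slot F e s ; φ = id ; slot-lift = λ _ _ → refl }

  private
    dead-end : ∀ {e v y z n} → Incident disjointEdges (inj₂ e) (inj₁ v) →
               Walk (Incident disjointEdges) (inj₁ v) y z n → inj₂ e ≡ y
    dead-end {y = inj₂ _} (_ , refl) (step (_ , refl))       = refl
    dead-end {y = inj₂ _} (_ , refl) ((_ , refl) ,⟨ _ ⟩ _) = refl

    -- The incidence graph is a disjoint union of stars: `(e , s)` lies in the edge `e` alone, so a
    -- walk cannot continue past it.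
    acyclic : ∀ {x y z n} → Walk (Incident disjointEdges) x y z n → x ≢ z
    acyclic {inj₁ _} {inj₂ _} (step _)                 = λ ()
    acyclic {inj₂ _} {inj₁ _} (step _)                 = λ ()
    acyclic {inj₂ _} {inj₁ _} (p ,⟨ x≢y′ ⟩ w)        = contradiction (dead-end p w) x≢y′
    acyclic {inj₁ _} {inj₂ _} (_ ,⟨ x≢y′ ⟩ step _)    = x≢y′
    acyclic {inj₁ _} {inj₂ _} (_,⟨_⟩_ {y′ = inj₁ _} _ _ (p ,⟨ y≢y″ ⟩ w)) =
      contradiction (dead-end p w) y≢y″

  disjointEdges-girth : ∀ g → Girth≥ (Incident disjointEdges) g
  disjointEdges-girth g w = contradiction refl (acyclic w)

-- Only the colourings constant over each node of F of index at least n count.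
PartlyRamsey : ∀ {R} {P F : Hypergraph R} → ℕ → Lift P F → ℕ → Set
PartlyRamsey {P = P} {F} k L n = (χ : Node P → Fin k) →
  (∀ j → n ℕ.≤ toℕ (index (node-finite F) j) → Σ[ c ∈ Fin k ] (∀ v → π L v ≡ j → χ v ≡ c)) →
  Monochromatic P χ

-- The Nešetřil–Rödl amalgamation: one copy of P for every edge of H, in which the
-- nodes over i are replaced by the nodes of that edge.
module _ {R : Set} {P F : Hypergraph R} (L : Lift P F) (i : Node F) (H : Hypergraph (Node P)) where

  private
    _≟_ : Binary.DecidableEquality (Node F)
    _≟_ = finite⇒≟ (node-finite F)

    copyNode : Edge H → Node P → Node H ⊎ (Edge H × Node P)
    copyNode e v with π L v ≟ i
    ... | yes _ = inj₁ (slot H e v)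
    ... | no  _ = inj₂ (e , v)

    copyNode-part : ∀ e {v} → π L v ≡ i → copyNode e v ≡ inj₁ (slot H e v)
    copyNode-part e {v} p with π L v ≟ i
    ... | yes _ = refl
    ... | no ¬p = contradiction p ¬p

  amalgam : Hypergraph R
  amalgam = record
    { Node        = Node H ⊎ (Edge H × Node P)
    ; Edge        = Edge H × Edge P
    ; node-finite = node-finite H ⊎-finite (edge-finite H ×-finite node-finite P)
    ; edge-finite = edge-finite H ×-finite edge-finite P
    ; slot        = λ (e , f) s → copyNode e (slot P f s)
    }

  private
    π′ : Node amalgam → Node F
    π′ (inj₁ _)       = i
    π′ (inj₂ (_ , v)) = π L v

    π′-copyNode : ∀ e v → π′ (copyNode e v) ≡ π L v
    π′-copyNode e v with π L v ≟ i
    ... | yes p = sym p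
    ... | no  _ = refl

  amalgam-lift : Lift amalgam F
  amalgam-lift = record
    { π         = π′
    ; φ         = φ L ∘ proj₂
    ; slot-lift = λ (e , f) s → trans (π′-copyNode e _) (slot-lift L f s)
    }

  private
    data Hub : Node P ⊎ Edge P → Node P → Set where
      hub : ∀ {v} → π L v ≡ i → Hub (inj₁ v) v

    copy : Edge H → Node P ⊎ Edge P → Node amalgam ⊎ Edge amalgam
    copy e = Sum.map (copyNode e) (e ,_)

    copyNode-injective : InjectiveSlots H → ∀ e → Injective _≡_ _≡_ (copyNode e)
    copyNode-injective inj e {u} {v} eq with π L u ≟ i | π L v ≟ i
    copyNode-injective inj e eq | yes _ | yes _ = inj e (inj₁-injective eq)
    copyNode-injective inj e refl | no _ | no _ = refl

    copyNode-shared : ∀ {e e′ u v} → e ≢ e′ → copyNode e u ≡ copyNode e′ v →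
      π L u ≡ i × π L v ≡ i × slot H e u ≡ slot H e′ v
    copyNode-shared {u = u} {v} e≢e′ eq with π L u ≟ i | π L v ≟ i
    ... | yes p | yes q = p , q , inj₁-injective eq
    ... | no _  | no _  = contradiction (cong proj₁ (inj₂-injective eq)) e≢e′

    -- A walk of length two would join two nodes of one edge in the part of `i`, but an edge meets
    -- each part at most once.
    distant : InjectiveSlots F → ∀ {a b c s t n} → Hub a s → Hub c t →
              Walk (Incident P) a b c n → 3 ℕ.≤ n
    distant inj {b = inj₂ _} (hub _) (hub _) (_ ,⟨ _ ⟩ (_ ,⟨ _ ⟩ w)) = s≤s (s≤s (Walk-positive w))
    distant inj {b = inj₂ f} (hub p) (hub q) (x ,⟨ u≢v ⟩ step y) =
      contradiction (cong inj₁ (part-edge L inj f x y p q)) u≢v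

  amalgam-gluing : InjectiveSlots F → InjectiveSlots H →
                   Gluing (Incident P) (Incident amalgam) H
  amalgam-gluing F-inj H-inj = record
    { copy           = copy
    ; copy-injective = λ { e {inj₁ _} {inj₁ _} eq → cong inj₁ (copyNode-injective H-inj e (inj₁-injective eq))
                         ; e {inj₂ _} {inj₂ _} refl → refl }
    ; cover          = λ
        { {inj₁ _} {inj₂ (e , f)} (s , eq) →
            e , inj₁ (slot P f s) , inj₂ f , (s , refl) , cong inj₁ eq , refl
        ; {inj₂ (e , f)} {inj₁ _} (s , eq) →
            e , inj₂ f , inj₁ (slot P f s) , (s , refl) , refl , cong inj₁ eq }
    ; Hub            = Hub
    ; Hub-injective  = λ { (hub _) (hub _) → refl }
    ; shared         = λ
        { {a = inj₁ u} {inj₁ v} e≢e′ eq →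
            let p , q , r = copyNode-shared e≢e′ (inj₁-injective eq) in u , v , hub p , hub q , r
        ; {a = inj₂ _} {inj₂ _} e≢e′ refl → contradiction refl e≢e′ }
    ; Hub-distant    = distant F-inj
    ; slot-injective = H-inj
    }

  -- A monochromatic edge of `H` makes the part of `i` constant in the copy over it, so the
  -- hypothesis on `P` applies inside that copy.
  amalgam-Ramsey : ∀ {k n} → toℕ (index (node-finite F) i) ≡ n → Ramsey k H →
                   PartlyRamsey k L n → PartlyRamsey k amalgam-lift (suc n)
  amalgam-Ramsey {k} {n} i≡n ramsey-H partly χ constant =
    let f , d , col = partly (χ ∘ copyNode e) constant′ in (e , f) , d , col
    where
    mono = ramsey-H (χ ∘ inj₁)
    e = proj₁ mono
    c = proj₁ (proj₂ mono)

    constant′ : ∀ j → n ℕ.≤ toℕ (index (node-finite F) j) →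
      Σ[ c ∈ Fin k ] (∀ v → π L v ≡ j → χ (copyNode e v) ≡ c)
    constant′ j n≤j with ℕ.m≤n⇒m<n∨m≡n n≤j
    ... | inj₁ n<j = map₂ (λ col v p → col (copyNode e v) (trans (π′-copyNode e v) p)) (constant j n<j)
    ... | inj₂ n≡j = c , λ v p →
      trans (cong χ (copyNode-part e (trans p (index-injective (node-finite F)
              (Fin.toℕ-injective (trans (sym n≡j) (sym i≡n)))))))
            (proj₂ (proj₂ mono) v)

record SparseLift (g k : ℕ) {R : Set} (F : Hypergraph R) : Set₁ where
  field
    hypergraph : Hypergraph R
    lift       : Lift hypergraph F
    girth      : Girth≥ (Incident hypergraph) g
    ramsey     : Ramsey k hypergraph

private
  no-short-walk : ∀ {R} (F : Hypergraph R) → Girth≥ (Incident F) 3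
  no-short-walk F {inj₁ _} {inj₂ _} (_ ,⟨ x≢x ⟩ step _) = contradiction refl x≢x
  no-short-walk F {inj₂ _} {inj₁ _} (_ ,⟨ x≢x ⟩ step _) = contradiction refl x≢x
  no-short-walk F (_ ,⟨ _ ⟩ _ ,⟨ _ ⟩ w) = s≤s (s≤s (Walk-positive w))

-- Induction on the girth, and within it on the parts: each amalgamation treats one more part and
-- glues along a hypergraph of girth `3 + j`, which keeps girth `4 + j`. The inner hypergraph has
-- `Node P` as its slots, hence the quantification over `R` and `F`.
sparseLift : ∀ j k {R} → Finite R → (F : Hypergraph R) → InjectiveSlots F → Ramsey (suc k) F →
             SparseLift (3 + j) (suc k) F
sparseLift zero k R-finite F F-inj F-ramsey = record
  { hypergraph = F
  ; lift       = record { π = id ; φ = id ; slot-lift = λ _ _ → refl }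
  ; girth      = no-short-walk F
  ; ramsey     = F-ramsey
  }
sparseLift (suc j) k {R} R-finite F F-inj F-ramsey =
  let P , L , P-girth , P-ramsey = amalgamate (size (node-finite F)) ℕ.≤-refl
  in record
    { hypergraph = P
    ; lift       = L
    ; girth      = P-girth
    -- All part indices lie below the size, so the constancy condition is vacuous.
    ; ramsey     = λ χ → P-ramsey χ λ i ≤i → contradiction ≤i (ℕ.<⇒≱ (Fin.toℕ<n _))
    }
  where
  amalgamate : ∀ n → n ℕ.≤ size (node-finite F) →
    Σ[ P ∈ Hypergraph R ] Σ[ L ∈ Lift P F ]
      Girth≥ (Incident P) (4 + j) × PartlyRamsey (suc k) L n
  amalgamate zero _ = disjointEdges R-finite F , disjointEdges-lift R-finite F
    , disjointEdges-girth R-finite F _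
    -- When all parts are monochromatic, the colouring descends to the nodes of `F`.
    , λ χ constant → let e , c , col = F-ramsey (λ i → proj₁ (constant i z≤n))
                     in e , c , λ s → trans (proj₂ (constant _ z≤n) (e , s) refl) (col s)
  amalgamate (suc n) n<a with amalgamate n (ℕ.<⇒≤ n<a)
  ... | P , L , P-girth , P-partly =
    amalgam L i hypergraph , amalgam-lift L i hypergraph
    , gluing-girth (amalgam-gluing L i hypergraph F-inj
        (lift-injective lift (pigeonholeHypergraph-injective (node-finite P) k)))
        (s≤s (s≤s (s≤s z≤n))) girth P-girth
    , amalgam-Ramsey L i hypergraph
        (trans (cong toℕ (index-element (node-finite F) _)) (Fin.toℕ-fromℕ< n<a)) ramsey P-partly
    where
    i = element (node-finite F) (fromℕ< n<a)
    open SparseLift (sparseLift j k (node-finite P) (pigeonholeHypergraph (node-finite P) k)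
      (pigeonholeHypergraph-injective (node-finite P) k)
      (pigeonholeHypergraph-Ramsey (node-finite P) k))

-- Box systems and Tutte's construction

-- `word` gives the position of a box and `level` its size. `height` strictly bounds every `top`, so
-- copies shifted by distinct multiples of it are disjoint.
record BoxSystem : Set₁ where
  field
    Carrier         : Set
    carrier-finite  : Finite Carrier
    digits         : List ℕ
    word           : Carrier → Word digits
    word-injective : Injective _≡_ _≡_ word
    level          : Carrier → ℕ
    bottom top     : Carrier → ℕ
    bottom≤top     : ∀ v → bottom v ℕ.≤ top v
    height         : ℕ
    top<height     : ∀ v → top v ℕ.< height

  Meet : Rel Carrier 0ℓ
  Meet u v = (Agree digits (level u) (word u) (word v) × Agree digits (level v) (word u) (word v))
           × (bottom u ℕ.≤ top v × bottom v ℕ.≤ top u)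

  Adjacent : Rel Carrier 0ℓ
  Adjacent u v = u ≢ v × Meet u v

  Adjacent? : Binary.Decidable Adjacent
  Adjacent? u v = ¬? (finite⇒≟ carrier-finite u v)
    ×-dec (Agree? digits _ _ _ ×-dec Agree? digits _ _ _) ×-dec (_ ℕ.≤? _ ×-dec _ ℕ.≤? _)

open BoxSystem

Uncolourable : ℕ → BoxSystem → Set
Uncolourable k S = (χ : Carrier S → Fin k) →
  Σ[ u ∈ Carrier S ] Σ[ v ∈ Carrier S ] Adjacent S u v × χ u ≡ χ v

module _ {A : Set} (_~_ : Rel A 0ℓ) where

  -- The graph with a pendant vertex inj₂ v attached to every vertex v.
  Pendant : Rel (A ⊎ A) 0ℓ
  Pendant (inj₁ u) (inj₁ v) = u ~ v
  Pendant (inj₁ u) (inj₂ v) = u ≡ v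
  Pendant (inj₂ u) (inj₁ v) = u ≡ v
  Pendant (inj₂ u) (inj₂ v) = ⊥

module _ {A : Set} {_~_ : Rel A 0ℓ} where

  private
    turn-back : ∀ {u b z n} → Walk (Pendant _~_) (inj₂ u) b z n → b ≡ inj₁ u
    turn-back {b = inj₁ _} (step refl)        = refl
    turn-back {b = inj₁ _} (refl ,⟨ _ ⟩ _)  = refl

    drop-end : ∀ {u b z n} → Walk (Pendant _~_) (inj₁ u) b (inj₁ z) n →
               ∃[ y ] b ≡ inj₁ y × Walk _~_ u y z n
    drop-end {b = inj₁ y} (step p) = y , refl , step p
    drop-end {b = inj₂ y} (refl ,⟨ u≢y′ ⟩ w) = contradiction (sym (turn-back w)) u≢y′
    drop-end {b = inj₁ y} (p ,⟨ u≢y′ ⟩ w) with drop-end w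
    ... | y′ , refl , w′ = y , refl , (p ,⟨ u≢y′ ∘ cong inj₁ ⟩ w′)

    drop-pendant-end : ∀ {u b z n} → Walk (Pendant _~_) (inj₁ u) b (inj₂ z) n →
      (b ≡ inj₂ z × u ≡ z) ⊎ (∃[ y ] b ≡ inj₁ y × ∃[ m ] m ℕ.≤ n × Walk _~_ u y z m)
    drop-pendant-end (step p) = inj₁ (refl , p)
    drop-pendant-end {b = inj₂ y} (refl ,⟨ u≢y′ ⟩ w) = contradiction (sym (turn-back w)) u≢y′
    drop-pendant-end {b = inj₁ y} (p ,⟨ u≢y′ ⟩ w) with drop-pendant-end w
    ... | inj₁ (refl , refl) = inj₂ (y , refl , 1 , s≤s z≤n , step p)
    ... | inj₂ (y′ , refl , m , m≤n , w′) =
      inj₂ (y , refl , suc m , s≤s m≤n , (p ,⟨ u≢y′ ∘ cong inj₁ ⟩ w′))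

  -- A pendant vertex can only be an end of a walk; removing it from both ends of a closed walk
  -- leaves a closed walk in the original graph.
  pendant-girth : ∀ {g} → Girth≥ _~_ g → Girth≥ (Pendant _~_) g
  pendant-girth girth {inj₁ _} w with drop-end w
  ... | _ , refl , w′ = girth w′
  pendant-girth girth {inj₂ _} {inj₁ _} (refl ,⟨ p≢b ⟩ w) with drop-pendant-end w
  ... | inj₁ (refl , _)                    = contradiction refl p≢b
  ... | inj₂ (_ , refl , m , m≤n , w′) = ℕ.m≤n⇒m≤1+n (ℕ.≤-trans (girth w′) m≤n)

  pendant-distant : ∀ {u b v n} → Walk (Pendant _~_) (inj₂ u) b (inj₂ v) n → 3 ℕ.≤ n
  pendant-distant {b = inj₁ _} (refl ,⟨ u≢v ⟩ step refl)      = contradiction refl u≢v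
  pendant-distant              (_ ,⟨ _ ⟩ _ ,⟨ _ ⟩ w) = s≤s (s≤s (Walk-positive w))

module _ (S : BoxSystem) (k : ℕ) where

  private
    Words = map (suc k *_) (digits S)

    subtree : (χ : Word Words → Fin (suc k)) →
      Σ[ c ∈ Fin (suc k) ] Σ[ f ∈ (Carrier S → Word Words) ] (∀ v → χ (f v) ≡ c)
    subtree χ = let c , f , col , _ = monochromaticSubtree k (digits S) χ
                in c , f ∘ word S , col ∘ word S

  subtreeHypergraph : Hypergraph (Carrier S)
  subtreeHypergraph = colouringHypergraph (Word-finite Words) (suc k) subtree

  subtreeHypergraph-Ramsey : Ramsey (suc k) subtreeHypergraph
  subtreeHypergraph-Ramsey = colouringHypergraph-Ramsey (Word-finite Words) (suc k) subtree

  subtree-agree : ∀ e j u v → Agree (digits S) j (word S u) (word S v) ⇔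
    Agree Words j (slot subtreeHypergraph e u) (slot subtreeHypergraph e v)
  subtree-agree e j u v =
    proj₂ (proj₂ (proj₂ (monochromaticSubtree k (digits S) _))) j (word S u) (word S v)

  subtreeHypergraph-injective : InjectiveSlots subtreeHypergraph
  subtreeHypergraph-injective e {u} {v} eq = word-injective S (Agree-zero⇒≡ (digits S)
    (Equivalence.from (subtree-agree e 0 u v)
      (subst (Agree Words 0 (slot subtreeHypergraph e u)) eq (Agree-refl Words 0 _))))

  -- Tutte's construction: the nodes of P are pairwise non-adjacent tall boxes of
  -- tiny width, each edge of P carries a copy of S at a height of its own, and every
  -- vertex of the copy is placed within reach of the corresponding node of the edge.
  module _ (P : Hypergraph (Carrier S)) (L : Lift P subtreeHypergraph) where
    private
      V  = Node P ⊎ (Edge P × Carrier S)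
      M  = size (edge-finite P)
      -- Two new least digits: the tag tells a node from the vertices anchored at it and these from
      -- each other, the second digit separates nodes of `P` over the same word.
      ds = suc M ∷ size (node-finite P) ∷ Words

      ⌊_⌋ : Node P → Fin (size (node-finite P))
      ⌊_⌋ = index (node-finite P)

      ⌈_⌉ : Edge P → Fin M
      ⌈_⌉ = index (edge-finite P)

      tag : V → Fin (suc M)
      tag (inj₁ _)       = zero
      tag (inj₂ (e , _)) = suc ⌈ e ⌉

      anchor : V → Node P
      anchor (inj₁ y)       = y
      anchor (inj₂ (e , v)) = slot P e v

      w′ : V → Word ds
      w′ x = tag x , ⌊ anchor x ⌋ , π L (anchor x)

      level′ : V → ℕ
      -- Level 1 ignores the tag alone, so a node reaches only what is anchored at it. Level
      -- `2 + level S v` ignores both new digits, which restores the relation of `S` within a copy.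
      level′ (inj₁ y)       = 1
      level′ (inj₂ (_ , v)) = 2 + level S v

      base : Edge P → ℕ
      base e = toℕ ⌈ e ⌉ * height S

      bottom′ top′ : V → ℕ
      bottom′ (inj₁ y)       = 0
      bottom′ (inj₂ (e , v)) = base e + bottom S v
      top′ (inj₁ y)       = M * height S
      top′ (inj₂ (e , v)) = base e + top S v

      w′-injective : Injective _≡_ _≡_ w′
      w′-injective {inj₁ _} {inj₁ _} eq =
        cong inj₁ (index-injective (node-finite P) (cong (proj₁ ∘ proj₂) eq))
      w′-injective {inj₂ (e , u)} {inj₂ (e′ , v)} eq
        with index-injective (edge-finite P) (Fin.suc-injective (cong proj₁ eq))
      ... | refl = cong (λ v → inj₂ (e , v)) (lift-injective L subtreeHypergraph-injective e
                     (index-injective (node-finite P) (cong (proj₁ ∘ proj₂) eq)))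

      bottom≤top′ : ∀ x → bottom′ x ℕ.≤ top′ x
      bottom≤top′ (inj₁ y)       = z≤n
      bottom≤top′ (inj₂ (e , v)) = ℕ.+-monoʳ-≤ (base e) (bottom≤top S v)

      next-base : ∀ e v → base e + top S v ℕ.< suc (toℕ ⌈ e ⌉) * height S
      next-base e v = subst (base e + top S v ℕ.<_) (ℕ.+-comm (base e) (height S))
                            (ℕ.+-monoʳ-< (base e) (top<height S v))

      top′≤ : ∀ x → top′ x ℕ.≤ M * height S
      top′≤ (inj₁ y)       = ℕ.≤-refl
      top′≤ (inj₂ (e , v)) = ℕ.≤-trans (ℕ.<⇒≤ (next-base e v)) (ℕ.*-monoˡ-≤ (height S) (Fin.toℕ<n ⌈ e ⌉))

    tutte : BoxSystem
    tutte = record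
      { Carrier         = V
      ; carrier-finite  = node-finite P ⊎-finite (edge-finite P ×-finite carrier-finite S)
      ; digits         = ds
      ; word           = w′
      ; word-injective = w′-injective
      ; level          = level′
      ; bottom         = bottom′
      ; top            = top′
      ; bottom≤top     = bottom≤top′
      ; height         = suc (M * height S)
      ; top<height     = s≤s ∘ top′≤
      }

    private
      agree-copy : ∀ e j u v → Agree (digits S) j (word S u) (word S v) ⇔
                   Agree Words j (π L (slot P e u)) (π L (slot P e v))
      agree-copy e j u v rewrite slot-lift L e u | slot-lift L e v = subtree-agree (φ L e) j u v

      overlap⇒≤ : ∀ e e′ u v → base e + bottom S u ℕ.≤ base e′ + top S v → toℕ ⌈ e ⌉ ℕ.≤ toℕ ⌈ e′ ⌉
      overlap⇒≤ e e′ u v le = ℕ.s≤s⁻¹ (ℕ.*-cancelʳ-< (height S) _ _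
        (ℕ.≤-<-trans (ℕ.≤-trans (ℕ.m≤m+n _ _) le) (next-base e′ v)))

      copy-adjacent : ∀ e {u v} → Adjacent S u v → Adjacent tutte (inj₂ (e , u)) (inj₂ (e , v))
      copy-adjacent e {u} {v} (u≢v , (p , q) , (r , s)) =
          (λ { refl → u≢v refl })
        , (Equivalence.to (agree-copy e _ u v) p , Equivalence.to (agree-copy e _ u v) q)
        , (ℕ.+-monoʳ-≤ (base e) r , ℕ.+-monoʳ-≤ (base e) s)

      copy-adjacent⁻¹ : ∀ e {u v} → Adjacent tutte (inj₂ (e , u)) (inj₂ (e , v)) → Adjacent S u v
      copy-adjacent⁻¹ e {u} {v} (u≢v , (p , q) , (r , s)) =
          (λ { refl → u≢v refl })
        , (Equivalence.from (agree-copy e _ u v) p , Equivalence.from (agree-copy e _ u v) q)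
        , (ℕ.+-cancelˡ-≤ (base e) _ _ r , ℕ.+-cancelˡ-≤ (base e) _ _ s)

      spoke : ∀ e v → Adjacent tutte (inj₁ (slot P e v)) (inj₂ (e , v))
      spoke e v = (λ ())
        , (Agree-refl (size (node-finite P) ∷ Words) 0 (⌊ slot P e v ⌋ , π L (slot P e v))
          , Agree-refl Words (level S v) (π L (slot P e v)))
        , (z≤n , ℕ.≤-trans (bottom≤top′ (inj₂ (e , v))) (top′≤ (inj₂ (e , v))))

    -- Over an edge of `P` with all nodes coloured `c`, either `c` recurs in the copy and a spoke is
    -- monochromatic, or the copy uses only `k` colours.
    tutte-uncolourable : Ramsey (suc k) P → Uncolourable k S → Uncolourable (suc k) tutte
    tutte-uncolourable P-ramsey S-uncol χ with P-ramsey (χ ∘ inj₁)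
    ... | e , c , col with Fin.any? (λ i → c Fin.≟ χ (inj₂ (e , element (carrier-finite S) i)))
    ... | yes (i , eq) = _ , _ , spoke e _ , trans (col _) eq
    ... | no ≢c =
      let u , v , adj , eq = S-uncol (λ v → punchOut (c≢ v))
      in _ , _ , copy-adjacent e adj , Fin.punchOut-injective (c≢ u) (c≢ v) eq
      where
      c≢ : ∀ v → c ≢ χ (inj₂ (e , v))
      c≢ v eq = ≢c (index (carrier-finite S) v
        , trans eq (cong (λ v → χ (inj₂ (e , v))) (sym (element-index (carrier-finite S) v))))

    private
      -- A pendant vertex becomes the node that its neighbour is joined to, so spokes are pendant
      -- edges and the pendant vertices are the hubs.
      copy : Edge P → Carrier S ⊎ Carrier S → V
      copy e (inj₁ v) = inj₂ (e , v)
      copy e (inj₂ v) = inj₁ (slot P e v)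

      data Hub : Carrier S ⊎ Carrier S → Carrier S → Set where
        hub : ∀ {v} → Hub (inj₂ v) v

      Covered : Rel V 0ℓ
      Covered x y = Σ[ e ∈ Edge P ] Σ[ a ∈ Carrier S ⊎ Carrier S ] Σ[ b ∈ Carrier S ⊎ Carrier S ]
        Pendant (Adjacent S) a b × (copy e a ≡ x) × (copy e b ≡ y)

      cover : ∀ {x y} → Adjacent tutte x y → Covered x y
      cover {inj₁ _} {inj₁ _} (x≢y , ((eq , _) , _) , _) =
        contradiction (cong inj₁ (index-injective (node-finite P) eq)) x≢y
      cover {inj₁ _} {inj₂ (e , v)} (_ , ((eq , _) , _) , _) =
        e , inj₂ v , inj₁ v , refl , cong inj₁ (sym (index-injective (node-finite P) eq)) , refl
      cover {inj₂ (e , v)} {inj₁ _} (_ , (_ , (eq , _)) , _) =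
        e , inj₁ v , inj₂ v , refl , refl , cong inj₁ (index-injective (node-finite P) eq)
      cover {inj₂ (e , u)} {inj₂ (e′ , v)} adj@(_ , _ , (p , q))
        with index-injective (edge-finite P)
               (Fin.toℕ-injective (ℕ.≤-antisym (overlap⇒≤ e e′ u v p) (overlap⇒≤ e′ e v u q)))
      ... | refl = e , inj₁ u , inj₁ v , copy-adjacent⁻¹ e adj , refl , refl

      P-injective : InjectiveSlots P
      P-injective = lift-injective L subtreeHypergraph-injective

      gluing : Gluing (Pendant (Adjacent S)) (Adjacent tutte) P
      gluing = record
        { copy           = copy
        ; copy-injective = λ
            { e {inj₁ _} {inj₁ _} refl → refl
            ; e {inj₂ _} {inj₂ _} eq   → cong inj₂ (P-injective e (inj₁-injective eq)) }
        ; cover          = cover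
        ; Hub            = Hub
        ; Hub-injective  = λ { hub hub → refl }
        ; shared         = λ
            { {a = inj₁ _} {inj₁ _} e≢e′ refl → contradiction refl e≢e′
            ; {a = inj₂ u} {inj₂ v} e≢e′ eq   → u , v , hub , hub , inj₁-injective eq }
        ; Hub-distant    = λ { hub hub → pendant-distant }
        ; slot-injective = P-injective
        }

    tutte-girth : ∀ {g} → 3 ℕ.≤ g → Girth≥ (Incident P) g → Girth≥ (Adjacent S) (suc g) →
                  Girth≥ (Adjacent tutte) (suc g)
    tutte-girth 3≤g P-girth S-girth = gluing-girth gluing 3≤g P-girth (pendant-girth S-girth)

singleVertex : BoxSystem
singleVertex = record
  { Carrier         = ⊤
  ; carrier-finite  = Word-finite []
  ; digits         = []
  ; word           = id
  ; word-injective = id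
  ; level          = λ _ → 0
  ; bottom         = λ _ → 0
  ; top            = λ _ → 0
  ; bottom≤top     = λ _ → z≤n
  ; height         = 1
  ; top<height     = λ _ → s≤s z≤n
  }

boxSystem : ∀ j k → Σ[ S ∈ BoxSystem ] Girth≥ (Adjacent S) (4 + j) × Uncolourable k S
boxSystem j zero = singleVertex , no-walk , λ χ → contradiction (χ tt) Fin.¬Fin0
  where
  no-walk : Girth≥ (Adjacent singleVertex) (4 + j)
  no-walk (step (x≢y , _))        = contradiction refl x≢y
  no-walk ((x≢y , _) ,⟨ _ ⟩ _)   = contradiction refl x≢y
boxSystem j (suc k) with boxSystem j k
... | S , S-girth , S-uncol =
  tutte S k hypergraph lift
  , tutte-girth S k hypergraph lift (s≤s (s≤s (s≤s z≤n))) girth S-girth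
  , tutte-uncolourable S k hypergraph lift ramsey S-uncol
  where open SparseLift (sparseLift j k (carrier-finite S) (subtreeHypergraph S k)
                          (subtreeHypergraph-injective S k) (subtreeHypergraph-Ramsey S k))

-- Realisation by boxes

-- Consecutive multiples of the base are 2n+1 apart while the least digit is below
-- n, so that words with different tails get positions more than n apart.
position : ∀ ns → Word ns → ℕ
position []       _       = 0
position (n ∷ ns) (a , w) = toℕ a + (1 + 2 * n) * position ns w

-- A bound for the change in position that the `j` least significant digits can cause.
radius : List ℕ → ℕ → ℕ
radius []       _       = 0
radius (n ∷ ns) zero    = 0
radius (n ∷ ns) (suc j) = n + (1 + 2 * n) * radius ns j

radius-zero : ∀ ns → radius ns 0 ≡ 0
radius-zero []       = refl
radius-zero (_ ∷ _) = refl

Agree⇒near : ∀ ns j {u w} → Agree ns j u w → position ns u ℕ.≤ position ns w + radius ns j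
Agree⇒near [] j p = z≤n
Agree⇒near (n ∷ ns) zero p with refl ← Agree-zero⇒≡ (n ∷ ns) p = ℕ.m≤m+n _ 0
Agree⇒near (n ∷ ns) (suc j) {a , u} {b , w} p = begin
  toℕ a + B * x                 ≤⟨ ℕ.+-mono-≤ (ℕ.<⇒≤ (Fin.toℕ<n a)) (ℕ.*-monoʳ-≤ B (Agree⇒near ns j p)) ⟩
  n + B * (y + r)               ≤⟨ ℕ.m≤n+m _ (toℕ b) ⟩
  toℕ b + (n + B * (y + r))     ≡⟨ lemma (toℕ b) n B y r ⟩
  toℕ b + B * y + (n + B * r)   ∎
  where
  open ℕ.≤-Reasoning
  B = 1 + 2 * n
  x = position ns u
  y = position ns w
  r = radius ns j
  lemma : ∀ b n B y r → b + (n + B * (y + r)) ≡ b + B * y + (n + B * r)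
  lemma b n B y r = solve (b ∷ n ∷ B ∷ y ∷ r ∷ [])

-- If `y + r < x`, the left side exceeds `(1 + 2 * n) * (y + r)` by at least `2 * n + 1`, the right
-- side by only `b + n`.
digit-carry : ∀ n a b x y r → b ℕ.< n →
  a + (1 + 2 * n) * x ℕ.≤ b + (1 + 2 * n) * y + (n + (1 + 2 * n) * r) → x ℕ.≤ y + r
digit-carry n a b x y r b<n le = ℕ.≮⇒≥ λ y+r<x → ℕ.<⇒≱ b<n (ℕ.+-cancelˡ-≤ (1 + n + (1 + 2 * n) * (y + r)) n b (begin
  1 + n + (1 + 2 * n) * (y + r) + n     ≡⟨ solve (n ∷ y ∷ r ∷ []) ⟩
  (1 + 2 * n) * (1 + (y + r))           ≤⟨ ℕ.*-monoʳ-≤ (1 + 2 * n) y+r<x ⟩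
  (1 + 2 * n) * x                       ≤⟨ ℕ.m≤n+m ((1 + 2 * n) * x) a ⟩
  a + (1 + 2 * n) * x                   ≤⟨ le ⟩
  b + (1 + 2 * n) * y + (n + (1 + 2 * n) * r)     ≡⟨ solve (n ∷ b ∷ y ∷ r ∷ []) ⟩
  n + (1 + 2 * n) * (y + r) + b         ≤⟨ ℕ.n≤1+n _ ⟩
  1 + n + (1 + 2 * n) * (y + r) + b     ∎))
  where
  open ℕ.≤-Reasoning

near⇒Agree : ∀ ns j {u w} → position ns u ℕ.≤ position ns w + radius ns j →
             position ns w ℕ.≤ position ns u + radius ns j → Agree ns j u w
near⇒Agree [] j p q = _
near⇒Agree (n ∷ ns) zero {a , u} {b , w} p q =
  -- The tails are shown equal first; they then cancel from both inequalities, which leaves the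
  -- first digits.
  finish (Agree-zero⇒≡ ns (near⇒Agree ns 0 {u} {w} (tail a b p) (tail b a q)))
  where
  tail : ∀ (a b : Fin n) {x y} → toℕ a + (1 + 2 * n) * x ℕ.≤ toℕ b + (1 + 2 * n) * y + 0 →
         x ℕ.≤ y + radius ns 0
  tail a b le rewrite radius-zero ns =
    digit-carry n (toℕ a) (toℕ b) _ _ 0 (Fin.toℕ<n b) (ℕ.≤-trans le (ℕ.+-monoʳ-≤ _ z≤n))
  head : ∀ {a b c} → a + c ℕ.≤ b + c + 0 → a ℕ.≤ b
  head {a} {b} {c} le = ℕ.+-cancelʳ-≤ c a b (subst (a + c ℕ.≤_) (ℕ.+-identityʳ _) le)
  finish : u ≡ w → a ≡ b × Agree ns 0 u w
  finish refl = Fin.toℕ-injective (ℕ.≤-antisym (head p) (head q)) , Agree-refl ns 0 u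
near⇒Agree (n ∷ ns) (suc j) {a , u} {b , w} p q = near⇒Agree ns j
  (digit-carry n (toℕ a) (toℕ b) _ _ _ (Fin.toℕ<n b) p)
  (digit-carry n (toℕ b) (toℕ a) _ _ _ (Fin.toℕ<n a) q)

position-injective : ∀ ns → Injective _≡_ _≡_ (position ns)
position-injective ns eq = Agree-zero⇒≡ ns (near⇒Agree ns 0
  (ℕ.≤-trans (ℕ.≤-reflexive eq) (ℕ.m≤m+n _ _)) (ℕ.≤-trans (ℕ.≤-reflexive (sym eq)) (ℕ.m≤m+n _ _)))

-- Natural and rational numbers as reals

private
  ≤⇒<+ : ∀ {p q ε} → p ℚ.≤ q → 0ℚ ℚ.< ε → p ℚ.< q ℚ.+ ε
  ≤⇒<+ {p} {q} {ε} p≤q 0<ε = subst (ℚ._< q ℚ.+ ε) (ℚ.+-identityʳ p) (ℚ.+-mono-≤-< p≤q 0<ε)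

  ∣p-p∣<ε : ∀ {p q ε} → p ≡ q → 0ℚ ℚ.< ε → ℚ.∣ p ℚ.- q ∣ ℚ.< ε
  ∣p-p∣<ε {p} {ε = ε} refl = subst (λ r → ℚ.∣ r ∣ ℚ.< ε) (sym (ℚ.+-inverseʳ p))

  cancel : ∀ p q → p ℚ.+ (q ℚ.- p) ≡ q
  cancel = solve′ 2 (λ p q → p :+ (q :- p) := q) refl
    where open +-*-Solver renaming (solve to solve′)

const : ℚ → ℝ
const q = mkℝ (λ _ → q) (λ ε 0<ε → 0 , λ _ _ _ _ → ∣p-p∣<ε {q} refl 0<ε)

const-mono : ∀ {p q} → p ℚ.≤ q → const p ≤ const q
const-mono p≤q ε 0<ε = 0 , λ _ _ → ≤⇒<+ p≤q 0<ε

const-cancel : ∀ {p q} → const p ≤ const q → p ℚ.≤ q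
const-cancel {p} {q} le = ℚ.≮⇒≥ λ q<p →
  -- At ε = p - q the bound `p < q + ε` becomes `p < p`.
  let N , lt = le (p ℚ.- q) (subst (ℚ._< p ℚ.- q) (ℚ.+-inverseʳ q) (ℚ.+-monoˡ-< (ℚ.- q) q<p))
  in ℚ.<-irrefl refl (subst (p ℚ.<_) (cancel q p) (lt N ℕ.≤-refl))

≤-trans : ∀ {x y z} → x ≤ y → y ≤ z → x ≤ z
≤-trans {x} {y} {z} x≤y y≤z ε 0<ε =
  let N , p = x≤y (½ ℚ.* ε) 0<½ε
      M , q = y≤z (½ ℚ.* ε) 0<½ε
  in N ℕ.⊔ M , λ n N⊔M≤n → begin-strict
    approx x n                            <⟨ p n (ℕ.m⊔n≤o⇒m≤o N M N⊔M≤n) ⟩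
    approx y n ℚ.+ ½ ℚ.* ε                <⟨ ℚ.+-monoˡ-< (½ ℚ.* ε) (q n (ℕ.m⊔n≤o⇒n≤o N M N⊔M≤n)) ⟩
    approx z n ℚ.+ ½ ℚ.* ε ℚ.+ ½ ℚ.* ε    ≡⟨ halves (approx z n) ε ⟩
    approx z n ℚ.+ ε                      ∎
  where
  open ℚ.≤-Reasoning
  0<½ε : 0ℚ ℚ.< ½ ℚ.* ε
  0<½ε = subst (ℚ._< ½ ℚ.* ε) (ℚ.*-zeroʳ ½) (ℚ.*-monoʳ-<-pos ½ 0<ε)
  halves : ∀ z ε → z ℚ.+ ½ ℚ.* ε ℚ.+ ½ ℚ.* ε ≡ z ℚ.+ ε
  halves = solve′ 2 (λ z e → z :+ con ½ :* e :+ con ½ :* e := z :+ e) refl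
    where open +-*-Solver renaming (solve to solve′)

fromℕℚ : ℕ → ℚ
fromℕℚ zero    = 0ℚ
fromℕℚ (suc n) = 1ℚ ℚ.+ fromℕℚ n

fromℕℚ-+ : ∀ m n → fromℕℚ (m + n) ≡ fromℕℚ m ℚ.+ fromℕℚ n
fromℕℚ-+ zero    n = sym (ℚ.+-identityˡ _)
fromℕℚ-+ (suc m) n = trans (cong (1ℚ ℚ.+_) (fromℕℚ-+ m n)) (sym (ℚ.+-assoc 1ℚ (fromℕℚ m) (fromℕℚ n)))

fromℕℚ-mono : ∀ {m n} → m ℕ.≤ n → fromℕℚ m ℚ.≤ fromℕℚ n
fromℕℚ-mono {n = zero}  z≤n = ℚ.≤-refl
fromℕℚ-mono {n = suc n} z≤n = ℚ.≤-trans (fromℕℚ-mono {n = n} z≤n)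
  (subst (ℚ._≤ 1ℚ ℚ.+ fromℕℚ n) (ℚ.+-identityˡ _) (ℚ.+-monoˡ-≤ (fromℕℚ n) (ℚ.nonNegative⁻¹ 1ℚ)))
fromℕℚ-mono (s≤s m≤n) = ℚ.+-monoʳ-≤ 1ℚ (fromℕℚ-mono m≤n)

fromℕℚ-cancel : ∀ {m n} → fromℕℚ m ℚ.≤ fromℕℚ n → m ℕ.≤ n
fromℕℚ-cancel {m} {n} le = ℕ.≮⇒≥ λ n<m → ℚ.<-irrefl refl (begin-strict
  fromℕℚ n           ≡⟨ ℚ.+-identityˡ _ ⟨
  0ℚ ℚ.+ fromℕℚ n    <⟨ ℚ.+-monoˡ-< (fromℕℚ n) (ℚ.positive⁻¹ 1ℚ) ⟩
  fromℕℚ (suc n)     ≤⟨ fromℕℚ-mono n<m ⟩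
  fromℕℚ m           ≤⟨ le ⟩
  fromℕℚ n           ∎)
  where open ℚ.≤-Reasoning

infix 8 _ʳ
_ʳ : ℕ → ℝ
n ʳ = const (fromℕℚ n)

_-ʳ_ : ℕ → ℕ → ℝ
m -ʳ n = const (fromℕℚ m ℚ.- fromℕℚ n)

ʳ-mono : ∀ {m n} → m ℕ.≤ n → m ʳ ≤ n ʳ
ʳ-mono = const-mono ∘ fromℕℚ-mono

ʳ-cancel : ∀ {m n} → m ʳ ≤ n ʳ → m ℕ.≤ n
ʳ-cancel {m} {n} = fromℕℚ-cancel ∘ const-cancel {fromℕℚ m} {fromℕℚ n}

private
  cancelʳ : ∀ p q → p ℚ.+ q ℚ.- q ≡ p
  cancelʳ = solve′ 2 (λ p q → p :+ q :- q := p) refl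
    where open +-*-Solver renaming (solve to solve′)

  cancelʳ′ : ∀ p q → p ℚ.- q ℚ.+ q ≡ p
  cancelʳ′ = solve′ 2 (λ p q → p :- q :+ q := p) refl
    where open +-*-Solver renaming (solve to solve′)

-ʳ-mono : ∀ m n s → m ℕ.≤ n + s → m -ʳ s ≤ n ʳ
-ʳ-mono m n s le = const-mono (begin
  fromℕℚ m ℚ.- fromℕℚ s                   ≤⟨ ℚ.+-monoˡ-≤ (ℚ.- fromℕℚ s) (fromℕℚ-mono le) ⟩
  fromℕℚ (n + s) ℚ.- fromℕℚ s             ≡⟨ cong (ℚ._- fromℕℚ s) (fromℕℚ-+ n s) ⟩
  fromℕℚ n ℚ.+ fromℕℚ s ℚ.- fromℕℚ s      ≡⟨ cancelʳ (fromℕℚ n) (fromℕℚ s) ⟩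
  fromℕℚ n                                ∎)
  where open ℚ.≤-Reasoning

-ʳ-cancel : ∀ m n s → m -ʳ s ≤ n ʳ → m ℕ.≤ n + s
-ʳ-cancel m n s le = fromℕℚ-cancel (begin
  fromℕℚ m                                ≡⟨ cancelʳ′ (fromℕℚ m) (fromℕℚ s) ⟨
  fromℕℚ m ℚ.- fromℕℚ s ℚ.+ fromℕℚ s      ≤⟨ ℚ.+-monoˡ-≤ (fromℕℚ s) (const-cancel {fromℕℚ m ℚ.- fromℕℚ s} {fromℕℚ n} le) ⟩
  fromℕℚ n ℚ.+ fromℕℚ s                   ≡⟨ fromℕℚ-+ n s ⟨
  fromℕℚ (n + s)                          ∎)
  where open ℚ.≤-Reasoning

-- Grounded boxes and their intersections

point : ℕ → ℕ → ℕ → Point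
point x y z 0F = x ʳ
point x y z 1F = y ʳ
point x y z 2F = z ʳ

groundedBox : ∀ (t s : ℕ) {c d} → c ℕ.≤ d → Box
groundedBox t s {c} {d} c≤d = record
  { lower = λ { 0F → t ʳ ; 1F → t -ʳ s ; 2F → c ʳ }
  ; upper = λ { 0F → (t + s) ʳ ; 1F → t ʳ ; 2F → d ʳ }
  ; lower≤upper = λ { 0F → ʳ-mono (ℕ.m≤m+n t s) ; 1F → -ʳ-mono t t s (ℕ.m≤m+n t s) ; 2F → ʳ-mono c≤d }
  }

module _ (t s : ℕ) {c d} (c≤d : c ℕ.≤ d) where

  groundedBox-square : IsSquare (groundedBox t s c≤d)
  groundedBox-square ε 0<ε = 0 , λ _ _ → ∣p-p∣<ε eq 0<ε
    where
    eq : fromℕℚ (t + s) ℚ.- fromℕℚ t ≡ fromℕℚ t ℚ.- (fromℕℚ t ℚ.- fromℕℚ s)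
    eq rewrite fromℕℚ-+ t s = solve′ 2 (λ t s → t :+ s :- t := t :- (t :- s)) refl (fromℕℚ t) (fromℕℚ s)
      where open +-*-Solver renaming (solve to solve′)

  point-∈ : ∀ {x y z} → t ℕ.≤ x → x ℕ.≤ t + s → t ℕ.≤ y + s → y ℕ.≤ t → c ℕ.≤ z → z ℕ.≤ d →
            ⟦ groundedBox t s c≤d ⟧ (point x y z)
  point-∈ a b c d e f 0F = ʳ-mono a , ʳ-mono b
  point-∈ {y = y} a b c d e f 1F = -ʳ-mono t y s c , ʳ-mono d
  point-∈ a b c d e f 2F = ʳ-mono e , ʳ-mono f

  corner-∈ : ⟦ groundedBox t s c≤d ⟧ (point t t c)
  corner-∈ = point-∈ ℕ.≤-refl (ℕ.m≤m+n t s) (ℕ.m≤m+n t s) ℕ.≤-refl ℕ.≤-refl c≤d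

  groundedBox-grounded : IsGrounded (groundedBox t s c≤d)
  groundedBox-grounded =
      (point t t c , corner-∈ , λ ε 0<ε → 0 , λ _ _ → ∣p-p∣<ε {fromℕℚ t} refl 0<ε)
    , λ p p∈ → ≤-trans {p 1F} {t ʳ} {p 0F} (proj₂ (p∈ 1F)) (proj₁ (p∈ 0F))

module _ {t s t′ s′ c d c′ d′ : ℕ} (c≤d : c ℕ.≤ d) (c′≤d′ : c′ ℕ.≤ d′) where

  private
    B  = groundedBox t s c≤d
    B′ = groundedBox t′ s′ c′≤d′

  groundedBox-meet : Satisfiable (⟦ B ⟧ ∩ ⟦ B′ ⟧) ⇔
    (((t ℕ.≤ t′ + s × t′ ℕ.≤ t + s) × (t ℕ.≤ t′ + s′ × t′ ℕ.≤ t + s′)) × (c ℕ.≤ d′ × c′ ℕ.≤ d))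
  groundedBox-meet = mk⇔ to from
    where
    through : ∀ {p} B B′ → ⟦ B ⟧ p → ⟦ B′ ⟧ p → ∀ i → lower B i ≤ upper B′ i
    through {p} B B′ p∈B p∈B′ i = ≤-trans {lower B i} {p i} {upper B′ i} (proj₁ (p∈B i)) (proj₂ (p∈B′ i))
    to : _ → _
    to (p , p∈B , p∈B′) =
      ( ( -ʳ-cancel t t′ s (through {p} B B′ p∈B p∈B′ 1F)
        , ʳ-cancel {t′} {t + s} (through {p} B′ B p∈B′ p∈B 0F))
      , ( ʳ-cancel {t} {t′ + s′} (through {p} B B′ p∈B p∈B′ 0F)
        , -ʳ-cancel t′ t s′ (through {p} B′ B p∈B′ p∈B 1F)))
      , ( ʳ-cancel {c} {d′} (through {p} B B′ p∈B p∈B′ 2F)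
        , ʳ-cancel {c′} {d} (through {p} B′ B p∈B′ p∈B 2F))
    from : _ → _
    from (((a , a′) , (b , b′)) , (e , e′)) =
      -- The first and last coordinates are the larger lower ends; the second is the smaller upper
      -- end, since the lower ends there may be negative.
      point (t ℕ.⊔ t′) (t ℕ.⊓ t′) (c ℕ.⊔ c′)
      , point-∈ t s c≤d (ℕ.m≤m⊔n t t′) (ℕ.⊔-lub (ℕ.m≤m+n t s) a′)
          (below (ℕ.m≤m+n t s) a) (ℕ.m⊓n≤m t t′) (ℕ.m≤m⊔n c c′) (ℕ.⊔-lub c≤d e′)
      , point-∈ t′ s′ c′≤d′ (ℕ.m≤n⊔m t t′) (ℕ.⊔-lub b (ℕ.m≤m+n t′ s′))
          (below b′ (ℕ.m≤m+n t′ s′)) (ℕ.m⊓n≤n t t′) (ℕ.m≤n⊔m c c′) (ℕ.⊔-lub e c′≤d′)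
      where
      below : ∀ {x r} → x ℕ.≤ t + r → x ℕ.≤ t′ + r → x ℕ.≤ t ℕ.⊓ t′ + r
      below {x} {r} p q = subst (x ℕ.≤_) (sym (ℕ.+-distribʳ-⊓ r t t′)) (ℕ.⊓-glb p q)

module _ (S : BoxSystem) where

  private
    t : Carrier S → ℕ
    t v = position (digits S) (word S v)
    s : Carrier S → ℕ
    s v = radius (digits S) (level S v)

  box : Carrier S → Box
  box v = groundedBox (t v) (s v) (bottom≤top S v)

  box-meet : ∀ u v → Satisfiable (⟦ box u ⟧ ∩ ⟦ box v ⟧) ⇔ Meet S u v
  box-meet u v = mk⇔
    (λ p → let (a , a′) , (b , b′) = proj₁ (Equivalence.to meet p) in
       (near⇒Agree (digits S) _ a a′ , near⇒Agree (digits S) _ b b′) , proj₂ (Equivalence.to meet p))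
    (λ ((a , b) , z) → Equivalence.from meet
       ( ( (Agree⇒near (digits S) _ a , Agree⇒near (digits S) _ (Agree-sym (digits S) _ a))
         , (Agree⇒near (digits S) _ b , Agree⇒near (digits S) _ (Agree-sym (digits S) _ b))) , z))
    where
    meet = groundedBox-meet {t u} {s u} {t v} {s v} (bottom≤top S u) (bottom≤top S v)

  -- Each box contains its corner on the plane, so mutual inclusion forces equal positions.
  box-injective : ∀ {u v} → ⟦ box u ⟧ ≐ ⟦ box v ⟧ → u ≡ v
  box-injective {u} {v} (⊆ , ⊇) = word-injective S (position-injective (digits S) (ℕ.≤-antisym
    (corner≤ v u (λ p → ⊇ {p})) (corner≤ u v (λ p → ⊆ {p}))))
    where
    corner≤ : ∀ u v → (∀ p → ⟦ box u ⟧ p → ⟦ box v ⟧ p) → t v ℕ.≤ t u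
    corner≤ u v ⊆ = ʳ-cancel {t v} {t u} (proj₁ (⊆ (point (t u) (t u) (bottom S u)) (corner-∈ (t u) (s u) (bottom≤top S u)) 0F))

  graph : SimpleGraph
  graph = record
    { Vertex = Carrier S
    ; Adj    = Adjacent S
    ; symm   = λ (u≢v , (a , b) , (c , d)) →
        u≢v ∘ sym , (Agree-sym (digits S) _ b , Agree-sym (digits S) _ a) , (d , c)
    ; irrefl = λ u≡v (u≢v , _) → u≢v u≡v
    }

  graph-groundedSquareBox : IsGroundedSquareBoxGraph graph
  graph-groundedSquareBox = size (carrier-finite S) , boxes
    , (λ i → square (element (carrier-finite S) i) , grounded (element (carrier-finite S) i))
    , element-injective ∘ box-injective
    , proj₂ (carrier-finite S)
    , λ u v → mk⇔ (to u v) (from u v)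
    where
    square : ∀ v → IsSquare (box v)
    square v = groundedBox-square (t v) (s v) (bottom≤top S v)
    grounded : ∀ v → IsGrounded (box v)
    grounded v = groundedBox-grounded (t v) (s v) (bottom≤top S v)
    boxes = box ∘ element (carrier-finite S)
    ix = index (carrier-finite S)
    element-injective : Injective _≡_ _≡_ (element (carrier-finite S))
    element-injective {i} {j} eq = trans (sym (index-element (carrier-finite S) i))
      (trans (cong ix eq) (index-element (carrier-finite S) j))
    Adj′ : Rel (Carrier S) 0ℓ
    Adj′ u v = ix u ≢ ix v × Satisfiable (⟦ boxes (ix u) ⟧ ∩ ⟦ boxes (ix v) ⟧)
    to : ∀ u v → Adjacent S u v → Adj′ u v
    to u v (u≢v , m) rewrite element-index (carrier-finite S) u | element-index (carrier-finite S) v =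
      u≢v ∘ index-injective (carrier-finite S) , Equivalence.from (box-meet u v) m
    from : ∀ u v → Adj′ u v → Adjacent S u v
    from u v (u≢v , m) rewrite element-index (carrier-finite S) u | element-index (carrier-finite S) v =
      u≢v ∘ cong ix , Equivalence.to (box-meet u v) m

-- Girth and chromatic number of finite graphs

module _ {A : Set} (FA : Finite A) where

  finite-all? : {P : A → Set} → Decidable P → Dec (∀ a → P a)
  finite-all? {P} P? = Dec.map′ (λ p a → subst P (element-index FA a) (p (index FA a)))
                                (λ p i → p (element FA i)) (Fin.all? (P? ∘ element FA))

  -- Functions are recovered from their codes only pointwise, so `P` has to respect `≗`.
  any-function? : ∀ {B} → Finite B → {P : (A → B) → Set} →
    (∀ {f h} → f ≗ h → P f → P h) → Decidable P → Dec (∃ P)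
  any-function? FB resp P? = Dec.map′ (λ (i , p) → decode FA FB i , p)
    (λ (f , p) → encode FA FB f , resp (sym ∘ decode-encode FA FB f) p)
    (Fin.any? (P? ∘ decode FA FB))

least : ∀ {P : ℕ → Set} → Decidable P → ∀ n →
  (∀ m → m ℕ.< n → ¬ P m) ⊎ (Σ[ m ∈ ℕ ] P m × (∀ l → P l → m ℕ.≤ l))
least P? zero = inj₁ λ _ ()
least P? (suc n) with least P? n
... | inj₂ found = inj₂ found
... | inj₁ none with P? n
... | yes p = inj₂ (n , p , λ l q → ℕ.≮⇒≥ λ l<n → none l l<n q)
... | no ¬p = inj₁ λ m m<1+n → λ p → Sum.[ (λ m<n → none m m<n p) , (λ { refl → ¬p p }) ]′
                (ℕ.m≤n⇒m<n∨m≡n (ℕ.s≤s⁻¹ m<1+n))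

-- The end `z` is kept apart from `f zero` because the recursion drops the first vertex.
closed-walk : ∀ {A : Set} {_~_ : Rel A 0ℓ} n (f : Fin (2 + n) → A) → Injective _≡_ _≡_ f →
  (∀ i → f (inject₁ i) ~ f (suc i)) → ∀ {z} → f (fromℕ (suc n)) ~ z →
  f (inject₁ (fromℕ n)) ≢ z → Walk _~_ (f zero) (f (suc zero)) z (2 + n)
closed-walk zero    f inj steps close f≢z = steps zero ,⟨ f≢z ⟩ step close
closed-walk (suc n) f inj steps close f≢z =
  steps zero ,⟨ (λ eq → contradiction (inj eq) λ ()) ⟩
  closed-walk n (f ∘ suc) (Fin.suc-injective ∘ inj) (steps ∘ suc) close f≢z

cycle-walk : ∀ {G} (C : Cycle G) → ∃[ x ] ∃[ y ] Walk (Adj G) x y x (Cycle.length C)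
cycle-walk record { last = suc (suc n) ; vertex = v ; injective = inj ; step = steps ; close = close } =
  _ , _ , closed-walk (suc n) v inj steps close (λ eq → contradiction (inj eq) λ ())
cycle-walk record { last = 1 ; 3≤length = s≤s (s≤s ()) }
cycle-walk record { last = 0 ; 3≤length = s≤s () }

module _ (G : SimpleGraph) (G-finite : Finite (Vertex G)) (Adj? : Binary.Decidable (Adj G)) where

  private
    _≟_ : Binary.DecidableEquality (Vertex G)
    _≟_ = finite⇒≟ G-finite

    IsCycle : ∀ n → (Fin (suc n) → Vertex G) → Set
    IsCycle n v = (∀ i j → v i ≡ v j → i ≡ j) × (∀ (i : Fin n) → Adj G (v (inject₁ i)) (v (suc i)))
                × Adj G (v (fromℕ n)) (v zero)

    IsCycle-resp : ∀ {n f h} → f ≗ h → IsCycle n f → IsCycle n h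
    IsCycle-resp eq (inj , steps , close) =
        (λ i j p → inj i j (trans (eq i) (trans p (sym (eq j)))))
      , (λ i → subst₂ (Adj G) (eq _) (eq _) (steps i))
      , subst₂ (Adj G) (eq _) (eq _) close

    IsCycle? : ∀ n → Decidable (IsCycle n)
    IsCycle? n v = Fin.all? (λ i → Fin.all? λ j → (v i ≟ v j) →-dec (i Fin.≟ j))
      ×-dec Fin.all? (λ i → Adj? (v (inject₁ i)) (v (suc i)))
      ×-dec Adj? (v (fromℕ n)) (v zero)

    CycleOfLength : ℕ → Set
    CycleOfLength n = Σ[ C ∈ Cycle G ] Cycle.length C ≡ n

    CycleOfLength? : Decidable CycleOfLength
    CycleOfLength? zero = no λ ()
    CycleOfLength? (suc n) = Dec.map′
      (λ (3≤ , v , inj , steps , close) → record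
        { last = n ; 3≤length = 3≤ ; vertex = v ; injective = inj _ _ ; step = steps ; close = close } , refl)
      (λ { (C , refl) → Cycle.3≤length C , Cycle.vertex C , (λ _ _ → Cycle.injective C) , Cycle.step C , Cycle.close C })
      ((3 ℕ.≤? suc n) ×-dec any-function? (_ , ↔-refl) G-finite IsCycle-resp (IsCycle? n))

    cycle-length≤ : ∀ (C : Cycle G) → Cycle.length C ℕ.≤ size G-finite
    cycle-length≤ C = Fin.injective⇒≤ (Cycle.injective C ∘ index-injective G-finite)

    Proper : ∀ {m} → (Vertex G → Fin m) → Set
    Proper c = ∀ u v → Adj G u v → c u ≢ c v

    Colorable? : Decidable (Colorable G)
    Colorable? m = any-function? G-finite (m , ↔-refl)
      (λ eq p u v uv e → p u v uv (trans (eq u) (trans e (sym (eq v)))))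
      (λ c → finite-all? G-finite λ u → finite-all? G-finite λ v → Adj? u v →-dec ¬? (c u Fin.≟ c v))

  girth-exists : ∀ g → Girth≥ (Adj G) g → ∃[ γ ] IsGirth G γ × [ g ] ≤⁺ γ
  girth-exists g girth with least CycleOfLength? (suc (size G-finite))
  -- A cycle has at most as many vertices as the graph, so the search was exhaustive.
  ... | inj₁ none = ⊤⁺ , (λ C → none _ (s≤s (cycle-length≤ C)) (C , refl)) , (_ ≤⊤⁺)
  ... | inj₂ (n , (C , refl) , n-least) =
    [ n ] , ((C , refl) , λ D → n-least _ (D , refl))
    , [ girth (proj₂ (proj₂ (cycle-walk C))) ]

  chromaticNumber-exists : ∀ k → ¬ Colorable G k → ∃[ χ ] IsChromaticNumber G χ × k ℕ.≤ χ
  chromaticNumber-exists k ¬colorable with least Colorable? (suc (size G-finite))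
  -- Giving every vertex its own colour is proper, so the search cannot fail.
  ... | inj₁ none = contradiction
    (index G-finite , λ u v uv eq → irrefl G (index-injective G-finite eq) uv)
    (none _ ℕ.≤-refl)
  ... | inj₂ (n , (c , proper) , n-least) =
    n , ((c , proper) , n-least) , ℕ.≮⇒≥ λ n<k → ¬colorable
      ( (λ v → inject≤ (c v) (ℕ.<⇒≤ n<k))
      , λ u v uv eq → proper u v uv (Fin.inject≤-injective _ _ _ _ eq))

theorem5 : ∀ (g k : ℕ) → 3 ℕ.≤ g → 1 ℕ.≤ k →
    Σ[ G ∈ SimpleGraph ]
    IsGroundedSquareBoxGraph G
    × (∃[ γ ] IsGirth G γ × [ g ] ≤⁺ γ)
    × (∃[ χ ] IsChromaticNumber G χ × k ℕ.≤ χ)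
-- Taking `j = g` gives girth at least `4 + g`, which avoids a subtraction.
theorem5 g k _ _ with boxSystem g k
... | S , girth , uncolourable =
    graph S
  , graph-groundedSquareBox S
  , girth-exists (graph S) (carrier-finite S) (Adjacent? S) g (λ w → ℕ.≤-trans (ℕ.m≤n+m g 4) (girth w))
  , chromaticNumber-exists (graph S) (carrier-finite S) (Adjacent? S) k
      (λ (χ , proper) → let u , v , uv , eq = uncolourable χ in proper u v uv eq)
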